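{- Let $F$ be a $4$-flipclass of $\mathfrak S_n$ with $t$-vector $t_F=(t_0,t_1,t_2,t_3,t_4)$. Then $c(F)$ depends only on $t_F$, and $$c(F)=\begin{cases}3,& \text{if } t_F\in\{(1,5,10,5,1),(1,8,14,8,1)\},\\ 2,& \text{if } t_1+t_3\ge 12 \text{ and } t_F\ne(1,8,14,8,1),\\ 1,& \text{otherwise.}\end{cases}$$
   Context: $\mathfrak S_n$: symmetric group on $[n]$, $\ell$ Coxeter length, $T$ transpositions. Bruhat graph: edge $x\xrightarrow{t}y$ whenever $yx^{ -1}=t\in T$ and $\ell(x)<\ell(y)$. $P_h(u,v)$: directed paths of length $h$ from $u$ to $v$. Between two elements there are 0 or 2 paths of length 2, each the flip of the other; $f_i$ ($i\in[h-1]$) replaces the subpath $x_{i-1}\to x_i\to x_{i+1}$ by its flip; an $h$-flipclass is an orbit in some $P_h(u,v)$ of the group generated by $f_1,\dots,f_{h-1}$. The $t$-vector of an $h$-flipclass $F$ is $(t_0,\dots,t_h)$ where $t_i$ is the number of distinct permutations $x$ such that some path $x_0\to\cdots\to x_h$ in $F$ has $x_i=x$. A total order $\preceq$ on $T$ is a reflection ordering if for all $a<b<c$ either $(a,b)\preceq(a,c)\preceq(b,c)$ or $(b,c)\preceq(a,c)\preceq(a,b)$; a path is increasing if its successive labels are weakly increasing for $\preceq$; $c(F)$ is the number of increasing paths in $F$ (independent of the reflection ordering). -}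

module Defs where

open import Data.Nat as ℕ using (ℕ; zero; suc; _+_; _<ᵇ_; _≤?_)
open import Data.Fin as Fin using (Fin; toℕ; inject₁)
open import Data.Fin.Permutation.Components using (transpose)
open import Data.Bool using (_∧_)
open import Data.List using (List; length; filterᵇ; cartesianProduct; allFin)
open import Data.List.Membership.Propositional using (_∈_)
open import Data.List.Relation.Unary.Unique.Propositional using (Unique)
open import Data.Vec as Vec using (Vec; lookup; _∷_; [])
open import Data.Vec.Properties using (≡-dec)
open import Data.Product using (Σ; ∃; _×_; _,_; proj₁; proj₂)
open import Data.Sum using (_⊎_)
open import Function.Bundles using (_⇔_)
open import Relation.Nullary using (¬_; yes; no)
open import Relation.Binary.PropositionalEquality using (_≡_; _≢_)
open import Relation.Binary.Structures using (IsTotalOrder)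
open import Relation.Binary.Construct.Closure.ReflexiveTransitive using (Star)

HasSize : {A : Set} → (A → Set) → ℕ → Set
HasSize {A} P k =
  Σ (List A) λ L → length L ≡ k × Unique L × (∀ x → P x ⇔ x ∈ L)

-- Permutations of [n] in one-line notation: x = (x(0), …, x(n-1)).

Word : ℕ → Set
Word n = Vec (Fin n) n

IsPerm : ∀ {n} → Word n → Set
IsPerm {n} x = ∀ (i j : Fin n) → lookup x i ≡ lookup x j → i ≡ j

-- Coxeter length = number of inversions.
len : ∀ {n} → Word n → ℕ
len {n} x = length (filterᵇ inv (cartesianProduct (allFin n) (allFin n)))
  where
  inv : Fin n × Fin n → _
  inv (i , j) = (toℕ i <ᵇ toℕ j) ∧ (toℕ (lookup x j) <ᵇ toℕ (lookup x i))

record Transp (n : ℕ) : Set where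
  constructor tr
  field
    a b : Fin n
    a<b : a Fin.< b

_·_ : ∀ {n} → Transp n → Word n → Word n
t · x = Vec.map (transpose (Transp.a t) (Transp.b t)) x

-- Bruhat graph edge x --t--> y : y x⁻¹ = t and ℓ(x) < ℓ(y).
Edge : ∀ {n} → Word n → Transp n → Word n → Set
Edge x t y = y ≡ t · x × len x ℕ.< len y

PathV : ℕ → ℕ → Set
PathV n h = Vec (Word n) (suc h)

IsPath : ∀ {n h} → PathV n h → Set
IsPath {n} {h} xs =
  (∀ (i : Fin (suc h)) → IsPerm (lookup xs i)) ×
  (∀ (i : Fin h) → ∃ λ t → Edge (lookup xs (inject₁ i)) t (lookup xs (Fin.suc i)))

IsPathFromTo : ∀ {n h} → Word n → Word n → PathV n h → Set
IsPathFromTo u v xs = IsPath xs × Vec.head xs ≡ u × Vec.last xs ≡ v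

-- Flip f_i (1 ≤ i ≤ h-1): q is obtained from the path p by replacing the
-- subpath x_{i-1} → x_i → x_{i+1} by the other path of length 2 between
-- x_{i-1} and x_{i+1} (there are exactly two such paths).
FlipStep : ∀ {n h} → PathV n h → PathV n h → Set
FlipStep {n} {h} p q =
  IsPath p × IsPath q ×
  Σ (Fin (suc h)) λ i →
    0 ℕ.< toℕ i × toℕ i ℕ.< h ×
    (∀ j → j ≢ i → lookup p j ≡ lookup q j) × lookup p i ≢ lookup q i

-- q lies in the flipclass (orbit under ⟨f₁,…,f_{h-1}⟩) of the path p.
InFlipclass : ∀ {n h} → PathV n h → PathV n h → Set
InFlipclass p q = Star FlipStep p q

-- The set of permutations occurring at position i among paths of the
-- flipclass of p; t_i is its cardinality.
TSet : ∀ {n h} → PathV n h → Fin (suc h) → Word n → Set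
TSet p i x = ∃ λ q → InFlipclass p q × lookup q i ≡ x

record ReflectionOrdering (n : ℕ) : Set₁ where
  field
    _≼_ : Transp n → Transp n → Set
    isTotalOrder : IsTotalOrder _≡_ _≼_
    reflection : ∀ (a b c : Fin n) (ab : a Fin.< b) (bc : b Fin.< c) (ac : a Fin.< c) →
      (tr a b ab ≼ tr a c ac × tr a c ac ≼ tr b c bc) ⊎
      (tr b c bc ≼ tr a c ac × tr a c ac ≼ tr a b ab)

Increasing : ∀ {n h} → ReflectionOrdering n → PathV n h → Set
Increasing {n} {h} O xs =
  ∀ (i j : Fin h) → toℕ j ≡ suc (toℕ i) → ∀ s t →
    Edge (lookup xs (inject₁ i)) s (lookup xs (Fin.suc i)) →
    Edge (lookup xs (inject₁ j)) t (lookup xs (Fin.suc j)) →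
    ReflectionOrdering._≼_ O s t

-- Increasing paths in the flipclass of p; c(F) is its cardinality.
IncSet : ∀ {n h} → ReflectionOrdering n → PathV n h → PathV n h → Set
IncSet O p q = InFlipclass p q × Increasing O q

cFormula : Vec ℕ 5 → ℕ
cFormula t with ≡-dec ℕ._≟_ t (1 ∷ 5 ∷ 10 ∷ 5 ∷ 1 ∷ [])
             | ≡-dec ℕ._≟_ t (1 ∷ 8 ∷ 14 ∷ 8 ∷ 1 ∷ [])
             | 12 ≤? (lookup t (Fin.suc Fin.zero) + lookup t (Fin.suc (Fin.suc (Fin.suc Fin.zero))))
... | yes _ | _     | _     = 3
... | no _  | yes _ | _     = 3
... | no _  | no _  | yes _ = 2
... | no _  | no _  | no _  = 1

{-# OPTIONS --safe #-}

-- All labels occurring in the flipclass of a path lie in the reflection subgroup generated by the labels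
-- of the path. For a path of length 4 this subgroup permutes the values within blocks B with
-- Σ (|B| - 1) ≤ 4, and whether a label leads upwards depends only on the relative order of the values and
-- of the positions within a block. So the flipclass is a copy of a flipclass in one of finitely many finite
-- models, one for each list of block sizes, and the claim is checked for all of these by evaluation.
-- A reflection ordering restricts to one on the labels of the model; the restrictions are explored as a
-- tree, by choosing the least remaining label again and again, while discarding the label sequences that
-- can no longer increase. The enumeration is cut down by considering only paths that increase for the
-- lexicographic ordering, as every flipclass contains one of them.

module Submission where

open import Defs
open import Data.Bool using (Bool; true; false; _∧_; _∨_; not; if_then_else_; T; T?)
open import Data.Empty using (⊥; ⊥-elim)
open import Data.Fin as Fin using (Fin; zero; suc; toℕ)
open import Data.Fin.Permutation.Components using (transpose; transpose-inverse)
import Data.Fin.Properties as Finₚ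
open import Data.List as List using (List; []; _∷_; _++_; length; map; concatMap; filter; filterᵇ; cartesianProduct; allFin)
import Data.List.Membership.DecPropositional as DecMembership
import Data.List.Properties as Listₚ
open import Data.List.Membership.Propositional using (_∈_; _∉_; find; lose)
open import Data.List.Membership.Propositional.Properties
open import Data.List.Relation.Binary.Disjoint.Propositional using (Disjoint)
open import Data.List.Relation.Binary.Permutation.Propositional as Perm using (_↭_)
import Data.List.Relation.Binary.Permutation.Propositional.Properties as Permₚ
open import Data.List.Relation.Binary.Subset.Propositional using (_⊆_)
open import Data.List.Relation.Unary.All as All using (All; []; _∷_)
import Data.List.Relation.Unary.All.Properties as Allₚ
open import Data.List.Relation.Unary.AllPairs as AllPairs using (AllPairs; []; _∷_)
import Data.List.Relation.Unary.AllPairs.Properties as AllPairsₚ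
open import Data.List.Relation.Unary.Any as Any using (Any; here; there)
import Data.List.Relation.Unary.Any.Properties as Anyₚ
open import Data.List.Relation.Unary.Linked using (Linked; []; [-]; _∷_)
import Data.List.Relation.Unary.Linked.Properties as Linkedₚ
open import Data.List.Relation.Unary.Unique.Propositional using (Unique)
import Data.List.Relation.Unary.Unique.Propositional.Properties as Uniqueₚ
open import Data.Nat as ℕ using (ℕ; zero; suc; _+_; _*_; z≤n; s≤s; _≡ᵇ_; pred)
open import Data.Nat.ListAction using (sum)
import Data.Nat.ListAction.Properties as Sumₚ
open import Data.Nat.Induction using (<-wellFounded)
import Data.Nat.Properties as ℕₚ
open import Data.Product as Product using (Σ; ∃; ∃₂; _×_; _,_; proj₁; proj₂)
open import Data.Sum as Sum using (_⊎_; inj₁; inj₂)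
open import Data.Unit using (tt)
open import Data.Vec as Vec using (Vec; []; _∷_; lookup; _[_]≔_)
import Data.Vec.Properties as Vecₚ
import Data.Vec.Relation.Unary.All as VecAll
open import Function using (_∘_; id)
open import Induction.WellFounded using (Acc; acc)
open import Function.Bundles using (mk⇔; Equivalence)
open import Relation.Binary.Construct.Closure.ReflexiveTransitive as Star using (Star; ε; _◅_; _◅◅_)
open import Relation.Binary.Definitions using (tri<; tri≈; tri>)
open import Relation.Binary.PropositionalEquality using (_≡_; _≢_; refl; sym; trans; cong; cong₂; subst; subst₂)
open import Relation.Binary.Structures using (IsTotalOrder)
open import Relation.Nullary using (¬_; Dec; yes; no; does)

-- For the same reason the computed `flips` exhaust the flips in the symmetric group. The bound 4
-- arises because each of the four labels merges at most two blocks, which start as singletons. That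
-- a flipclass contains a lexicographically increasing path is itself reduced to evaluation: at a
-- descent l, m some flip has a first label smaller than l, and lowering first labels terminates.
-- Independence of c(F) from the ordering comes out of the same computation, since every branch of
-- the tree must reach the one number that `cFormula` assigns to the t-vector. What ties the tree to
-- the theorem is that an arbitrary reflection ordering of the symmetric group follows one of its
-- branches. The cost of evaluation shapes the encoding: the model with one block of five values
-- already has 120 states and 768 reflection orderings.

-- Finite lists and cardinalities.

unique-⊆⇒length≤ : ∀ {A : Set} {xs ys : List A} → Unique xs → xs ⊆ ys → length xs ℕ.≤ length ys
unique-⊆⇒length≤ {xs = []} _ _ = z≤n
unique-⊆⇒length≤ {xs = x ∷ xs} (x∉xs ∷ uniq) xs⊆ys with ∈-∃++ (xs⊆ys (here refl))
... | as , bs , refl = begin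
  suc (length xs)             ≤⟨ s≤s (unique-⊆⇒length≤ uniq xs⊆as++bs) ⟩
  suc (length (as ++ bs))     ≡⟨ cong suc (Listₚ.length-++ as) ⟩
  suc (length as + length bs) ≡⟨ ℕₚ.+-suc (length as) (length bs) ⟨
  length as + suc (length bs) ≡⟨ Listₚ.length-++ as ⟨
  length (as ++ x ∷ bs)       ∎
  where
  open ℕₚ.≤-Reasoning
  xs⊆as++bs : xs ⊆ as ++ bs
  xs⊆as++bs y∈xs with ∈-++⁻ as (xs⊆ys (there y∈xs))
  ... | inj₁ y∈as         = ∈-++⁺ˡ y∈as
  ... | inj₂ (here refl)  = ⊥-elim (All.lookup x∉xs y∈xs refl)
  ... | inj₂ (there y∈bs) = ∈-++⁺ʳ as y∈bs

unique-map⁺ : ∀ {A B : Set} {f : A → B} {xs : List A} →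
  (∀ {x y} → x ∈ xs → y ∈ xs → f x ≡ f y → x ≡ y) → Unique xs → Unique (map f xs)
unique-map⁺ inj [] = []
unique-map⁺ {f = f} inj (x∉xs ∷ uniq) =
  Allₚ.map⁺ (All.tabulate (λ y∈xs fx≡fy → All.lookup x∉xs y∈xs (inj (here refl) (there y∈xs) fx≡fy)))
  ∷ unique-map⁺ (λ x∈ y∈ → inj (there x∈) (there y∈)) uniq

-- Identifies the t-vector given in the theorem with the one computed in a model, so that `cFormula`
-- may be evaluated on the latter.
HasSize-unique : ∀ {A : Set} {P : A → Set} {k l} → HasSize P k → HasSize P l → k ≡ l
HasSize-unique (xs , refl , xs! , P⇔xs) (ys , refl , ys! , P⇔ys) = ℕₚ.≤-antisym
  (unique-⊆⇒length≤ xs! (λ {x} x∈ → Equivalence.to (P⇔ys x) (Equivalence.from (P⇔xs x) x∈)))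
  (unique-⊆⇒length≤ ys! (λ {x} x∈ → Equivalence.to (P⇔xs x) (Equivalence.from (P⇔ys x) x∈)))

∧-true⁻ : ∀ {a b} → a ∧ b ≡ true → a ≡ true × b ≡ true
∧-true⁻ {true} {true} _ = refl , refl

false≢true : ∀ {A : Set} → false ≡ true → A
false≢true ()

Vec-ext : ∀ {A : Set} {m} {xs ys : Vec A m} → (∀ i → lookup xs i ≡ lookup ys i) → xs ≡ ys
Vec-ext {xs = []} {[]} _ = refl
Vec-ext {xs = x ∷ xs} {y ∷ ys} eq = cong₂ _∷_ (eq zero) (Vec-ext (eq ∘ suc))

-- Pigeonhole: a missed value v would extend the n distinct values of x to n + 1 distinct elements
-- of `Fin n`.
perm-surjective : ∀ {n} (x : Word n) → IsPerm x → ∀ v → ∃ λ j → lookup x j ≡ v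
perm-surjective {n} x perm v with Finₚ.any? (λ j → lookup x j Finₚ.≟ v)
... | yes hit = hit
... | no ¬hit = ⊥-elim (ℕₚ.1+n≰n (subst₂ ℕ._≤_
    (cong suc (trans (Listₚ.length-map (lookup x) (allFin n)) (Listₚ.length-tabulate {n = n} id))) (Listₚ.length-tabulate {n = n} id)
    (unique-⊆⇒length≤ v∷image! (λ {w} _ → ∈-allFin w))))
  where
  v∷image! : Unique (v ∷ map (lookup x) (allFin n))
  v∷image! = Allₚ.map⁺ (All.tabulate (λ {j} _ v≡xj → ¬hit (j , sym v≡xj)))
    ∷ unique-map⁺ (λ {i} {j} _ _ → perm i j) (Uniqueₚ.allFin⁺ n)

-- Transpositions and their action on words.

module _ {n : ℕ} (a b : Fin n) where

  transpose-left : transpose a b a ≡ b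
  transpose-left with a Finₚ.≟ a
  ... | yes _  = refl
  ... | no a≢a = ⊥-elim (a≢a refl)

  transpose-right : transpose a b b ≡ a
  transpose-right with b Finₚ.≟ a
  ... | yes b≡a = b≡a
  ... | no _ with b Finₚ.≟ b
  ...   | yes _  = refl
  ...   | no b≢b = ⊥-elim (b≢b refl)

  transpose-fixed : ∀ {v} → v ≢ a → v ≢ b → transpose a b v ≡ v
  transpose-fixed {v} v≢a v≢b with v Finₚ.≟ a
  ... | yes v≡a = ⊥-elim (v≢a v≡a)
  ... | no _ with v Finₚ.≟ b
  ...   | yes v≡b = ⊥-elim (v≢b v≡b)
  ...   | no _    = refl

  data TransposeView : Fin n → Set where
    left  : TransposeView a
    right : TransposeView b
    fixed : ∀ {v} → v ≢ a → v ≢ b → TransposeView v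

  transposeView : ∀ v → TransposeView v
  transposeView v with v Finₚ.≟ a
  ... | yes refl = left
  ... | no v≢a with v Finₚ.≟ b
  ...   | yes refl = right
  ...   | no v≢b   = fixed v≢a v≢b

transpose-comm : ∀ {n} (a b v : Fin n) → transpose a b v ≡ transpose b a v
transpose-comm a b v with transposeView a b v
... | left          = trans (transpose-left a b) (sym (transpose-right b a))
... | right         = trans (transpose-right a b) (sym (transpose-left b a))
... | fixed v≢a v≢b = trans (transpose-fixed a b v≢a v≢b) (sym (transpose-fixed b a v≢b v≢a))

transpose-involutive : ∀ {n} (a b v : Fin n) → transpose a b (transpose a b v) ≡ v
transpose-involutive a b v = trans (cong (transpose a b) (transpose-comm a b v)) (transpose-inverse a b)

transpose-injective : ∀ {n} (a b : Fin n) {v w} → transpose a b v ≡ transpose a b w → v ≡ w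
transpose-injective a b {v} {w} eq =
  trans (sym (transpose-involutive a b v)) (trans (cong (transpose a b) eq) (transpose-involutive a b w))

-- For f a transposition this is the formula for conjugates; for `f = lookup x` it turns a swap of
-- values into a swap of positions.
transpose-natural : ∀ {m n} (f : Fin m → Fin n) → (∀ {v w} → f v ≡ f w → v ≡ w) →
  ∀ a b v → f (transpose a b v) ≡ transpose (f a) (f b) (f v)
transpose-natural f inj a b v with transposeView a b v
... | left          = trans (cong f (transpose-left a b)) (sym (transpose-left (f a) (f b)))
... | right         = trans (cong f (transpose-right a b)) (sym (transpose-right (f a) (f b)))
... | fixed v≢a v≢b = trans (cong f (transpose-fixed a b v≢a v≢b)) (sym (transpose-fixed (f a) (f b) (v≢a ∘ inj) (v≢b ∘ inj)))

swapValues : ∀ {n} → Fin n → Fin n → Word n → Word n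
swapValues a b = Vec.map (transpose a b)

swapValues-involutive : ∀ {n} (a b : Fin n) x → swapValues a b (swapValues a b x) ≡ x
swapValues-involutive a b x = trans (sym (Vecₚ.map-∘ _ _ x)) (trans (Vecₚ.map-cong (transpose-involutive a b) x) (Vecₚ.map-id x))

swapValues-perm : ∀ {n} (a b : Fin n) x → IsPerm x → IsPerm (swapValues a b x)
swapValues-perm a b x perm i j eq = perm i j (transpose-injective a b
  (trans (sym (Vecₚ.lookup-map i _ x)) (trans eq (Vecₚ.lookup-map j _ x))))

lookup-swapValues : ∀ {n} (x : Word n) → IsPerm x → ∀ {a b p q} → lookup x p ≡ a → lookup x q ≡ b →
  ∀ j → lookup (swapValues a b x) j ≡ lookup x (transpose p q j)
lookup-swapValues x perm {p = p} {q} refl refl j =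
  trans (Vecₚ.lookup-map j _ x) (sym (transpose-natural (lookup x) (perm _ _) p q j))

-- Inversions and the change of length under a transposition.

IsInv : ∀ {n} → Word n → Fin n × Fin n → Set
IsInv x (i , j) = i Fin.< j × lookup x j Fin.< lookup x i

isInv? : ∀ {n} (x : Word n) ij → Dec (IsInv x ij)
isInv? x (i , j) with i Finₚ.<? j | lookup x j Finₚ.<? lookup x i
... | yes p | yes q = yes (p , q)
... | no ¬p | _     = no (¬p ∘ proj₁)
... | _     | no ¬q = no (¬q ∘ proj₂)

invᵇ : ∀ {n} → Word n → Fin n × Fin n → Bool
invᵇ x (i , j) = (toℕ i ℕ.<ᵇ toℕ j) ∧ (toℕ (lookup x j) ℕ.<ᵇ toℕ (lookup x i))

invs : ∀ {n} → Word n → List (Fin n × Fin n)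
invs {n} x = filterᵇ (invᵇ x) (cartesianProduct (allFin n) (allFin n))

∈-invs⁺ : ∀ {n} (x : Word n) {ij} → IsInv x ij → ij ∈ invs x
∈-invs⁺ x {i , j} (i<j , xj<xi) = ∈-filter⁺ (T? ∘ invᵇ x)
  (∈-cartesianProduct⁺ (∈-allFin i) (∈-allFin j)) (both (ℕₚ.<⇒<ᵇ i<j) (ℕₚ.<⇒<ᵇ xj<xi))
  where
  both : ∀ {p q} → T p → T q → T (p ∧ q)
  both {true} _ tq = tq

∈-invs⁻ : ∀ {n} (x : Word n) {ij} → ij ∈ invs x → IsInv x ij
∈-invs⁻ {n} x {i , j} ij∈ = split (proj₂ (∈-filter⁻ (T? ∘ invᵇ x) {xs = cartesianProduct (allFin n) (allFin n)} ij∈))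
  where
  split : T (invᵇ x (i , j)) → IsInv x (i , j)
  split t with toℕ i ℕ.<ᵇ toℕ j in eq
  ... | true = ℕₚ.<ᵇ⇒< _ _ (subst T (sym eq) tt) , ℕₚ.<ᵇ⇒< _ _ t

invs-unique : ∀ {n} (x : Word n) → Unique (invs x)
invs-unique {n} x = Uniqueₚ.filter⁺ (T? ∘ invᵇ x) (Uniqueₚ.cartesianProduct⁺ (Uniqueₚ.allFin⁺ n) (Uniqueₚ.allFin⁺ n))

module _ {n} (x : Word n) (perm : IsPerm x) {a b p q : Fin n}
         (xp≡a : lookup x p ≡ a) (xq≡b : lookup x q ≡ b) (p<q : p Fin.< q) (a<b : a Fin.< b) where

  private
    y : Word n
    y = swapValues a b x

    y≗ : ∀ j → lookup y j ≡ lookup x (transpose p q j)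
    y≗ = lookup-swapValues x perm xp≡a xq≡b

    yp≡b : lookup y p ≡ b
    yp≡b = trans (y≗ p) (trans (cong (lookup x) (transpose-left p q)) xq≡b)

    yq≡a : lookup y q ≡ a
    yq≡a = trans (y≗ q) (trans (cong (lookup x) (transpose-right p q)) xp≡a)

    y-off : ∀ {j} → j ≢ p → j ≢ q → lookup y j ≡ lookup x j
    y-off j≢p j≢q = trans (y≗ _) (cong (lookup x) (transpose-fixed p q j≢p j≢q))

    σ² : Fin n × Fin n → Fin n × Fin n
    σ² (i , j) = transpose p q i , transpose p q j

    σ²-value : ∀ {i j} → IsInv x (i , j) → lookup y (transpose p q j) Fin.< lookup y (transpose p q i)
    σ²-value {i} {j} (_ , xj<xi) = subst₂ Fin._<_ (sym (back j)) (sym (back i)) xj<xi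
      where
      back : ∀ k → lookup y (transpose p q k) ≡ lookup x k
      back k = trans (y≗ _) (cong (lookup x) (transpose-involutive p q k))

    -- Only pairs (q , j) and (i , p) with a third index can be lost; they move to (p , j) and (i ,
    -- q). The second component makes `φ` injective: a kept inversion is an inversion of x, a moved
    -- one is not.
    lost-inversion : ∀ {ij} → IsInv x ij → ¬ IsInv y ij → IsInv y (σ² ij) × ¬ IsInv x (σ² ij)
    lost-inversion {i , j} inv ¬inv = (proj₁ order , σ²-value inv) , proj₂ order
      where
      <p : ∀ {v w} → v Fin.< w → w ≡ a → v Fin.< b
      <p v<w refl = Finₚ.<-trans v<w a<b
      order : transpose p q i Fin.< transpose p q j × ¬ IsInv x (σ² (i , j))
      order with transposeView p q i | transposeView p q j
      ... | left | left = ⊥-elim (Finₚ.<-irrefl refl (proj₁ inv))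
      ... | left | right = ⊥-elim (Finₚ.<-asym a<b (subst₂ Fin._<_ xq≡b xp≡a (proj₂ inv)))
      ... | left | fixed j≢p j≢q = ⊥-elim (¬inv (proj₁ inv ,
          subst₂ Fin._<_ (sym (y-off j≢p j≢q)) (sym yp≡b) (<p (proj₂ inv) xp≡a)))
      ... | right | left = ⊥-elim (Finₚ.<-asym p<q (proj₁ inv))
      ... | right | right = ⊥-elim (Finₚ.<-irrefl refl (proj₁ inv))
      ... | right | fixed j≢p j≢q rewrite transpose-right p q | transpose-fixed p q j≢p j≢q =
          Finₚ.<-trans p<q (proj₁ inv) ,
          λ inv′ → ¬inv (proj₁ inv , subst₂ Fin._<_ (sym (y-off j≢p j≢q)) (trans xp≡a (sym yq≡a)) (proj₂ inv′))
      ... | fixed i≢p i≢q | left rewrite transpose-left p q | transpose-fixed p q i≢p i≢q =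
          Finₚ.<-trans (proj₁ inv) p<q ,
          λ inv′ → ¬inv (proj₁ inv , subst₂ Fin._<_ (trans xq≡b (sym yp≡b)) (sym (y-off i≢p i≢q)) (proj₂ inv′))
      ... | fixed i≢p i≢q | right = ⊥-elim (¬inv (proj₁ inv ,
          subst₂ Fin._<_ (sym yq≡a) (sym (y-off i≢p i≢q)) (Finₚ.<-trans a<b (subst (Fin._< _) xq≡b (proj₂ inv)))))
      ... | fixed i≢p i≢q | fixed j≢p j≢q = ⊥-elim (¬inv (proj₁ inv ,
          subst₂ Fin._<_ (sym (y-off j≢p j≢q)) (sym (y-off i≢p i≢q)) (proj₂ inv)))

    φ : Fin n × Fin n → Fin n × Fin n
    φ ij with isInv? y ij
    ... | yes _ = ij
    ... | no _  = σ² ij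

    φ-inv : ∀ {ij} → IsInv x ij → IsInv y (φ ij)
    φ-inv {ij} inv with isInv? y ij
    ... | yes inv′ = inv′
    ... | no ¬inv  = proj₁ (lost-inversion inv ¬inv)

    φ-injective : ∀ {ij kl} → IsInv x ij → IsInv x kl → φ ij ≡ φ kl → ij ≡ kl
    φ-injective {ij} {kl} inv inv′ eq with isInv? y ij | isInv? y kl
    ... | yes _ | yes _  = eq
    ... | yes _ | no ¬kl = ⊥-elim (proj₂ (lost-inversion inv′ ¬kl) (subst (IsInv x) eq inv))
    ... | no ¬ij | yes _ = ⊥-elim (proj₂ (lost-inversion inv ¬ij) (subst (IsInv x) (sym eq) inv′))
    ... | no _  | no _   = cong₂ _,_ (transpose-injective p q (cong proj₁ eq)) (transpose-injective p q (cong proj₂ eq))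

    φ-misses : ∀ {ij} → IsInv x ij → (p , q) ≢ φ ij
    φ-misses {ij} inv eq with isInv? y ij
    φ-misses (_ , v<) refl | yes _ = Finₚ.<-asym a<b (subst₂ Fin._<_ xq≡b xp≡a v<)
    φ-misses {i , j} (i<j , _) eq | no _ = Finₚ.<-asym p<q (subst₂ Fin._<_
      (trans (sym (transpose-involutive p q i)) (trans (cong (transpose p q) (sym (cong proj₁ eq))) (transpose-left p q)))
      (trans (sym (transpose-involutive p q j)) (trans (cong (transpose p q) (sym (cong proj₂ eq))) (transpose-right p q)))
      i<j)

  -- An inversion of x that is lost in y is moved by exchanging the positions p and q; the
  -- resulting injection misses the new inversion (p , q).
  len-swapValues : len x ℕ.< len y
  len-swapValues = subst₂ ℕ._<_ (Listₚ.length-map φ (invs x)) refl (unique-⊆⇒length≤ {xs = (p , q) ∷ map φ (invs x)}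
    (Allₚ.map⁺ (All.tabulate (φ-misses ∘ ∈-invs⁻ x))
      ∷ unique-map⁺ (λ ij∈ kl∈ → φ-injective (∈-invs⁻ x ij∈) (∈-invs⁻ x kl∈)) (invs-unique x))
    λ where
      (here refl) → ∈-invs⁺ y (p<q , subst₂ Fin._<_ (sym yq≡a) (sym yp≡b) a<b)
      (there ij∈) → image ij∈)
    where
    image : ∀ {ij} → ij ∈ map φ (invs x) → ij ∈ invs y
    image ij∈ with ∈-map⁻ φ ij∈
    ... | kl , kl∈ , refl = ∈-invs⁺ y (φ-inv (∈-invs⁻ x kl∈))

-- For q < p the word `swapValues a b x` carries a to the left of b, so by `len-swapValues` swapping
-- back to x would lengthen it as well.
len-swapValues⁻ : ∀ {n} (x : Word n) → IsPerm x → ∀ {a b p q} → lookup x p ≡ a → lookup x q ≡ b →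
  a Fin.< b → len x ℕ.< len (swapValues a b x) → p Fin.< q
len-swapValues⁻ x perm {a} {b} {p} {q} xp≡a xq≡b a<b longer with Finₚ.<-cmp p q
... | tri< p<q _ _ = p<q
... | tri≈ _ refl _ = ⊥-elim (Finₚ.<-irrefl (trans (sym xp≡a) xq≡b) a<b)
... | tri> _ _ q<p = ⊥-elim (ℕₚ.<-asym longer (subst (len (swapValues a b x) ℕ.<_) (cong len (swapValues-involutive a b x))
    (len-swapValues (swapValues a b x) (swapValues-perm a b x perm) {p = q} {q = p}
      (trans (Vecₚ.lookup-map q _ x) (trans (cong (transpose a b) xq≡b) (transpose-right a b)))
      (trans (Vecₚ.lookup-map p _ x) (trans (cong (transpose a b) xp≡a) (transpose-left a b))) q<p a<b)))

-- Factorisations of a product of two transpositions.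

-- A transposition described by its action. This is symmetric in a and b, whereas `transpose a b`
-- and `transpose b a` agree only pointwise; the symmetry cuts down the cases below.
record IsSwap {n} (f : Fin n → Fin n) (a b : Fin n) : Set where
  field
    swap-left  : f a ≡ b
    swap-right : f b ≡ a
    swap-fixed : ∀ {v} → v ≢ a → v ≢ b → f v ≡ v

open IsSwap

isSwap-sym : ∀ {n} {f : Fin n → Fin n} {a b} → IsSwap f a b → IsSwap f b a
isSwap-sym s = record
  { swap-left = swap-right s ; swap-right = swap-left s ; swap-fixed = λ v≢b v≢a → swap-fixed s v≢a v≢b }

transpose-isSwap : ∀ {n} (a b : Fin n) → IsSwap (transpose a b) a b
transpose-isSwap a b = record
  { swap-left = transpose-left a b ; swap-right = transpose-right a b ; swap-fixed = transpose-fixed a b }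

SamePair : ∀ {n} (a b c d : Fin n) → Set
SamePair a b c d = (a ≡ c × b ≡ d) ⊎ (a ≡ d × b ≡ c)

samePair-swapˡ : ∀ {n} {a b c d : Fin n} → SamePair a b c d → SamePair b a c d
samePair-swapˡ (inj₁ (p , q)) = inj₂ (q , p)
samePair-swapˡ (inj₂ (p , q)) = inj₁ (q , p)

samePair-swapʳ : ∀ {n} {a b c d : Fin n} → SamePair a b c d → SamePair a b d c
samePair-swapʳ (inj₁ eqs) = inj₂ eqs
samePair-swapʳ (inj₂ eqs) = inj₁ eqs

samePair-trans : ∀ {n} {a b c d e f : Fin n} → SamePair a b c d → SamePair c d e f → SamePair a b e f
samePair-trans (inj₁ (refl , refl)) q = q
samePair-trans (inj₂ (refl , refl)) q = samePair-swapˡ q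

-- For transpositions s = (a b) and t = (c d): {z , w} is the support of the first factor in one of
-- the factorisations t ∘ s = (t s t) ∘ t = s ∘ (t s t), the last one holding if s and t do not commute.
data FirstFactor {n} (s t : Fin n → Fin n) (a b c d z w : Fin n) : Set where
  first     : SamePair z w a b → FirstFactor s t a b c d z w
  second    : SamePair z w c d → FirstFactor s t a b c d z w
  conjugate : SamePair z w (t a) (t b) →
    (∀ r → IsSwap r (t a) (t b) → ∀ v → s (r v) ≡ t (s v)) → FirstFactor s t a b c d z w

firstFactor-swap₁ : ∀ {n} {s t : Fin n → Fin n} {a b c d z w} → FirstFactor s t b a c d z w → FirstFactor s t a b c d z w
firstFactor-swap₁ (first p)       = first (samePair-swapʳ p)
firstFactor-swap₁ (second p)      = second p
firstFactor-swap₁ (conjugate p r) = conjugate (samePair-swapʳ p) (λ f sw → r f (isSwap-sym sw))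

firstFactor-swap₂ : ∀ {n} {s t : Fin n → Fin n} {a b c d z w} → FirstFactor s t a b d c z w → FirstFactor s t a b c d z w
firstFactor-swap₂ (first p)       = first p
firstFactor-swap₂ (second p)      = second (samePair-swapʳ p)
firstFactor-swap₂ (conjugate p r) = conjugate p r

firstFactor-trans : ∀ {n} {s t : Fin n → Fin n} {a b c d z w z′ w′} →
  SamePair z′ w′ z w → FirstFactor s t a b c d z w → FirstFactor s t a b c d z′ w′
firstFactor-trans q (first p)       = first (samePair-trans q p)
firstFactor-trans q (second p)      = second (samePair-trans q p)
firstFactor-trans q (conjugate p r) = conjugate (samePair-trans q p) r

module _ {n} {s t : Fin n → Fin n} where

  -- t ∘ s is the 3-cycle taking a to b, b to d and d to a. The pairs of a point and its image are
  -- therefore the supports {a , b} of s, {b , d} of t s t and {d , a} of t.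
  firstFactor-sharing : ∀ {a b d} → IsSwap s a b → IsSwap t a d → a ≢ b → a ≢ d → b ≢ d →
    ∀ z → t (s z) ≢ z → FirstFactor s t a b a d z (t (s z))
  firstFactor-sharing {a} {b} {d} sw tw a≢b a≢d b≢d z moved with z Finₚ.≟ a | z Finₚ.≟ b | z Finₚ.≟ d
  ... | yes refl | _ | _ = first (inj₁ (refl , trans (cong t (swap-left sw)) tb≡b))
    where tb≡b = swap-fixed tw (a≢b ∘ sym) b≢d
  ... | no z≢a | yes refl | _ = conjugate (inj₂ (sym tb≡b , cong t (swap-right sw))) rotate
    where
    tb≡b = swap-fixed tw (a≢b ∘ sym) b≢d
    -- Transpositions that share one point satisfy s t s = t s t, so r = t s t gives s r = t s.
    rotate : ∀ r → IsSwap r (t a) (t b) → ∀ v → s (r v) ≡ t (s v)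
    rotate r rw v with subst₂ (IsSwap r) (swap-left tw) tb≡b rw
    ... | rw with v Finₚ.≟ a | v Finₚ.≟ b | v Finₚ.≟ d
    ...   | yes refl | _ | _ = trans (cong s (swap-fixed rw a≢d a≢b)) (trans (swap-left sw) (sym (trans (cong t (swap-left sw)) tb≡b)))
    ...   | no _ | yes refl | _ = trans (cong s (swap-right rw)) (trans (swap-fixed sw (a≢d ∘ sym) (b≢d ∘ sym))
            (sym (trans (cong t (swap-right sw)) (swap-left tw))))
    ...   | no _ | no _ | yes refl = trans (cong s (swap-left rw)) (trans (swap-right sw)
            (sym (trans (cong t (swap-fixed sw (a≢d ∘ sym) (b≢d ∘ sym))) (swap-right tw))))
    ...   | no v≢a | no v≢b | no v≢d = trans (cong s (swap-fixed rw v≢d v≢b))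
            (sym (trans (cong t (swap-fixed sw v≢a v≢b)) (trans (swap-fixed tw v≢a v≢d) (sym (swap-fixed sw v≢a v≢b)))))
  ... | no z≢a | no z≢b | yes refl = second (inj₂ (refl , trans (cong t (swap-fixed sw z≢a z≢b)) (swap-right tw)))
  ... | no z≢a | no z≢b | no z≢d = ⊥-elim (moved (trans (cong t (swap-fixed sw z≢a z≢b)) (swap-fixed tw z≢a z≢d)))

  firstFactor-disjoint : ∀ {a b c d} → IsSwap s a b → IsSwap t c d → a ≢ c → a ≢ d → b ≢ c → b ≢ d →
    ∀ z → t (s z) ≢ z → FirstFactor s t a b c d z (t (s z))
  firstFactor-disjoint {a} {b} {c} {d} sw tw a≢c a≢d b≢c b≢d z moved with z Finₚ.≟ a | z Finₚ.≟ b
  ... | yes refl | _ = first (inj₁ (refl , trans (cong t (swap-left sw)) (swap-fixed tw b≢c b≢d)))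
  ... | no _ | yes refl = first (inj₂ (refl , trans (cong t (swap-right sw)) (swap-fixed tw a≢c a≢d)))
  ... | no z≢a | no z≢b with z Finₚ.≟ c | z Finₚ.≟ d
  ...   | yes refl | _ = second (inj₁ (refl , trans (cong t (swap-fixed sw z≢a z≢b)) (swap-left tw)))
  ...   | no _ | yes refl = second (inj₂ (refl , trans (cong t (swap-fixed sw z≢a z≢b)) (swap-right tw)))
  ...   | no z≢c | no z≢d = ⊥-elim (moved (trans (cong t (swap-fixed sw z≢a z≢b)) (swap-fixed tw z≢c z≢d)))

  firstFactor-moved : ∀ {a b c d} → IsSwap s a b → IsSwap t c d → a ≢ b → c ≢ d → ¬ SamePair a b c d →
    ∀ z → t (s z) ≢ z → FirstFactor s t a b c d z (t (s z))
  firstFactor-moved {a} {b} {c} {d} sw tw a≢b c≢d differ z moved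
    with a Finₚ.≟ c | a Finₚ.≟ d | b Finₚ.≟ c | b Finₚ.≟ d
  ... | yes refl | _ | _ | yes refl = ⊥-elim (differ (inj₁ (refl , refl)))
  ... | yes refl | _ | _ | no b≢d = firstFactor-sharing sw tw a≢b c≢d b≢d z moved
  ... | no _ | yes refl | yes refl | _ = ⊥-elim (differ (inj₂ (refl , refl)))
  ... | no a≢c | yes refl | no b≢c | _ =
    firstFactor-swap₂ (firstFactor-sharing sw (isSwap-sym tw) a≢b a≢c b≢c z moved)
  ... | no a≢c | no a≢d | yes refl | _ =
    firstFactor-swap₁ (firstFactor-sharing (isSwap-sym sw) tw (a≢b ∘ sym) c≢d a≢d z moved)
  ... | no a≢c | no a≢d | no b≢c | yes refl =
    firstFactor-swap₁ (firstFactor-swap₂ (firstFactor-sharing (isSwap-sym sw) (isSwap-sym tw) (a≢b ∘ sym) b≢c a≢c z moved))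
  ... | no a≢c | no a≢d | no b≢c | no b≢d = firstFactor-disjoint sw tw a≢c a≢d b≢c b≢d z moved

  -- One of the two points of s′ is fixed by t′, so {a′ , b′} = {z , t (s z)} for z = a′ or z = b′.
  firstFactor : ∀ {s′ t′ : Fin n → Fin n} {a b c d a′ b′ c′ d′} → IsSwap s a b → IsSwap t c d →
    IsSwap s′ a′ b′ → IsSwap t′ c′ d′ → a ≢ b → c ≢ d → ¬ SamePair a b c d → a′ ≢ b′ →
    (∀ v → t′ (s′ v) ≡ t (s v)) → FirstFactor s t a b c d a′ b′
  firstFactor {s′} {t′} {a} {b} {c} {d} {a′} {b′} {c′} {d′} sw tw sw′ tw′ a≢b c≢d differ a′≢b′ same =
    search (b′ Finₚ.≟ c′) (b′ Finₚ.≟ d′) (a′ Finₚ.≟ c′) (a′ Finₚ.≟ d′)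
    where
    from : ∀ z w → z ≢ w → t (s z) ≡ w → FirstFactor s t a b c d z w
    from z w z≢w refl = firstFactor-moved sw tw a≢b c≢d differ z (z≢w ∘ sym)
    b′-fixed : b′ ≢ c′ → b′ ≢ d′ → FirstFactor s t a b c d a′ b′
    b′-fixed b′≢c′ b′≢d′ = from a′ b′ a′≢b′ (trans (sym (same a′)) (trans (cong t′ (swap-left sw′)) (swap-fixed tw′ b′≢c′ b′≢d′)))
    a′-fixed : a′ ≢ c′ → a′ ≢ d′ → FirstFactor s t a b c d a′ b′
    a′-fixed a′≢c′ a′≢d′ = firstFactor-trans (inj₂ (refl , refl))
      (from b′ a′ (a′≢b′ ∘ sym) (trans (sym (same b′)) (trans (cong t′ (swap-right sw′)) (swap-fixed tw′ a′≢c′ a′≢d′))))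
    -- Here s′ and t′ have the same support, so t ∘ s is the identity and s, t have the same support
    -- too, against `differ`.
    cancel : t′ b′ ≡ a′ → t′ a′ ≡ b′ → FirstFactor s t a b c d a′ b′
    cancel t′b′≡a′ t′a′≡b′ = ⊥-elim (absurd (b Finₚ.≟ c) (b Finₚ.≟ d))
      where
      swapped : IsSwap t′ a′ b′
      swapped with a′ Finₚ.≟ c′ | a′ Finₚ.≟ d′
      ... | yes refl | _ = subst (IsSwap t′ a′) (trans (sym (swap-left tw′)) t′a′≡b′) tw′
      ... | no _ | yes refl = subst (IsSwap t′ a′) (trans (sym (swap-right tw′)) t′a′≡b′) (isSwap-sym tw′)
      ... | no a′≢c′ | no a′≢d′ = ⊥-elim (a′≢b′ (trans (sym (swap-fixed tw′ a′≢c′ a′≢d′)) t′a′≡b′))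
      id-on : ∀ v → t (s v) ≡ v
      id-on v with v Finₚ.≟ a′ | v Finₚ.≟ b′
      ... | yes refl | _ = trans (sym (same v)) (trans (cong t′ (swap-left sw′)) t′b′≡a′)
      ... | no _ | yes refl = trans (sym (same v)) (trans (cong t′ (swap-right sw′)) t′a′≡b′)
      ... | no v≢a′ | no v≢b′ = trans (sym (same v)) (trans (cong t′ (swap-fixed sw′ v≢a′ v≢b′)) (swap-fixed swapped v≢a′ v≢b′))
      tb≡a : t b ≡ a
      tb≡a = trans (cong t (sym (swap-left sw))) (id-on a)
      absurd : Dec (b ≡ c) → Dec (b ≡ d) → ⊥
      absurd (yes refl) _ = differ (inj₂ (trans (sym tb≡a) (swap-left tw) , refl))
      absurd _ (yes refl) = differ (inj₁ (trans (sym tb≡a) (swap-right tw) , refl))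
      absurd (no b≢c) (no b≢d) = a≢b (trans (sym tb≡a) (swap-fixed tw b≢c b≢d))
    search : Dec (b′ ≡ c′) → Dec (b′ ≡ d′) → Dec (a′ ≡ c′) → Dec (a′ ≡ d′) → FirstFactor s t a b c d a′ b′
    search (no b′≢c′) (no b′≢d′) _ _ = b′-fixed b′≢c′ b′≢d′
    search _ _ (no a′≢c′) (no a′≢d′) = a′-fixed a′≢c′ a′≢d′
    search (yes refl) _ (yes refl) _ = ⊥-elim (a′≢b′ refl)
    search (yes refl) _ _ (yes refl) = cancel (swap-left tw′) (swap-right tw′)
    search _ (yes refl) (yes refl) _ = cancel (swap-right tw′) (swap-left tw′)
    search _ (yes refl) _ (yes refl) = ⊥-elim (a′≢b′ refl)

-- Labels, paths and flips.

swapValues-pointwise : ∀ {n} (x : Word n) → IsPerm x → (f g : Fin n → Fin n) →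
  Vec.map f x ≡ Vec.map g x → ∀ v → f v ≡ g v
swapValues-pointwise x perm f g eq v with perm-surjective x perm v
... | j , refl = trans (sym (Vecₚ.lookup-map j f x)) (trans (cong (λ y → lookup y j) eq) (Vecₚ.lookup-map j g x))

transpose-unique : ∀ {n} {a b c d : Fin n} → a Fin.< b → c Fin.< d →
  (∀ v → transpose a b v ≡ transpose c d v) → a ≡ c × b ≡ d
transpose-unique {a = a} {b} {c} {d} a<b c<d eq with transposeView c d a | trans (sym (transpose-left a b)) (eq a)
... | left  | b≡ = refl , trans b≡ (transpose-left c d)
... | right | b≡ = ⊥-elim (Finₚ.<-asym a<b (subst (Fin._< d) (sym (trans b≡ (transpose-right c d))) c<d))
... | fixed a≢c a≢d | b≡ = ⊥-elim (Finₚ.<-irrefl (sym (trans b≡ (transpose-fixed c d a≢c a≢d))) a<b)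

label-unique : ∀ {n} (x : Word n) → IsPerm x → {s t : Transp n} → s · x ≡ t · x → s ≡ t
label-unique x perm {tr a b a<b} {tr c d c<d} eq
  with transpose-unique a<b c<d (swapValues-pointwise x perm (transpose a b) (transpose c d) eq)
... | refl , refl = cong (tr a b) (Finₚ.<-irrelevant a<b c<d)

-- An inductive form of `IsPath`, so that proofs recurse on the path instead of on indices.
data Path {n} : ∀ {h} → PathV n h → Set where
  end  : ∀ {x} → IsPerm x → Path (x ∷ [])
  step : ∀ {h x y} {ys : Vec (Word n) h} → IsPerm x → (t : Transp n) → Edge x t y → Path (y ∷ ys) → Path (x ∷ y ∷ ys)

path⁺ : ∀ {n h} {xs : PathV n h} → IsPath xs → Path xs
path⁺ {xs = x ∷ []} (perms , _) = end (perms zero)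
path⁺ {xs = x ∷ y ∷ ys} (perms , edges) =
  step (perms zero) (proj₁ (edges zero)) (proj₂ (edges zero)) (path⁺ (perms ∘ suc , edges ∘ suc))

path⁻ : ∀ {n h} {xs : PathV n h} → Path xs → IsPath xs
path⁻ (end perm) = (λ where zero → perm) , λ ()
path⁻ (step perm t edge path) =
  (λ where zero → perm ; (suc i) → proj₁ (path⁻ path) i) ,
  (λ where zero → t , edge ; (suc i) → proj₂ (path⁻ path) i)

labels : ∀ {n h} {xs : PathV n h} → Path xs → Vec (Transp n) h
labels (end _)           = []
labels (step _ t _ path) = t ∷ labels path

-- The index condition of `FlipStep` in inductive form: in `here` the changed vertex has a neighbour
-- on both sides, which is 0 < i < h.
data OneInnerChange {n} : ∀ {h} → PathV n h → PathV n h → Set where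
  here  : ∀ {h x y y′ z} {zs : Vec (Word n) h} → y ≢ y′ → OneInnerChange (x ∷ y ∷ z ∷ zs) (x ∷ y′ ∷ z ∷ zs)
  there : ∀ {h x} {ys zs : PathV n h} → OneInnerChange ys zs → OneInnerChange (x ∷ ys) (x ∷ zs)

oneInnerChange⁺ : ∀ {n h} (p q : PathV n h) (i : Fin (suc h)) → 0 ℕ.< toℕ i → toℕ i ℕ.< h →
  (∀ j → j ≢ i → lookup p j ≡ lookup q j) → lookup p i ≢ lookup q i → OneInnerChange p q
oneInnerChange⁺ {h = suc zero} (x ∷ y ∷ []) (x′ ∷ y′ ∷ []) (suc zero) _ (s≤s ()) _ _
oneInnerChange⁺ {h = suc (suc h)} (x ∷ y ∷ z ∷ zs) (x′ ∷ y′ ∷ z′ ∷ zs′) (suc zero) _ _ agree differ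
  with agree zero (λ ()) | agree (suc (suc zero)) (λ ()) | Vec-ext {xs = zs} {zs′} (λ j → agree (suc (suc (suc j))) (λ ()))
... | refl | refl | refl = here differ
oneInnerChange⁺ {h = suc h} (x ∷ p) (x′ ∷ q) (suc (suc i)) _ (s≤s i<h) agree differ with agree zero (λ ())
... | refl = there (oneInnerChange⁺ p q (suc i) (s≤s z≤n) i<h (λ j j≢i → agree (suc j) (j≢i ∘ Finₚ.suc-injective)) differ)

oneInnerChange⁻ : ∀ {n h} {p q : PathV n h} → OneInnerChange p q → Σ (Fin (suc h)) λ i →
  0 ℕ.< toℕ i × toℕ i ℕ.< h × (∀ j → j ≢ i → lookup p j ≡ lookup q j) × lookup p i ≢ lookup q i
oneInnerChange⁻ (here y≢y′) = suc zero , s≤s z≤n , s≤s (s≤s z≤n) , agree , y≢y′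
  where
  agree : ∀ j → j ≢ suc zero → _
  agree zero          _   = refl
  agree (suc zero)    j≢1 = ⊥-elim (j≢1 refl)
  agree (suc (suc j)) _   = refl
oneInnerChange⁻ (there change) with oneInnerChange⁻ change
... | i , _ , i<h , agree , differ = suc i , s≤s z≤n , s≤s i<h ,
  (λ where zero _ → refl ; (suc j) j≢i → agree j (j≢i ∘ cong suc)) , differ

flipStep⁺ : ∀ {n h} {p q : PathV n h} → Path p → Path q → OneInnerChange p q → FlipStep p q
flipStep⁺ p q change = path⁻ p , path⁻ q , oneInnerChange⁻ change

flipStep⁻ : ∀ {n h} {p q : PathV n h} → FlipStep p q → Path p × Path q × OneInnerChange p q
flipStep⁻ {p = p} {q} (isp , isq , i , 0<i , i<h , agree , differ) =
  path⁺ isp , path⁺ isq , oneInnerChange⁺ p q i 0<i i<h agree differ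

flipStep-sym : ∀ {n h} (p q : PathV n h) → FlipStep p q → FlipStep q p
flipStep-sym _ _ (isp , isq , i , 0<i , i<h , agree , differ) =
  isq , isp , i , 0<i , i<h , (λ j j≢i → sym (agree j j≢i)) , differ ∘ sym

inFlipclass-sym : ∀ {n h} {p q : PathV n h} → InFlipclass p q → InFlipclass q p
inFlipclass-sym = Star.reverse (λ {p} {q} → flipStep-sym p q)

-- Both constructors of `OneInnerChange` keep the first vertex; matching on them exposes it, and the
-- edge from x carries over.
flipStep-cons : ∀ {n h} {x} {p q : PathV n h} → Path (x ∷ p) → FlipStep p q → Path (x ∷ q) × FlipStep (x ∷ p) (x ∷ q)
flipStep-cons {x = x} {p} {q} path@(step px t edge _) flip with flipStep⁻ {p = p} {q} flip
... | _ , path′ , change@(here _)  = let path″ = step px t edge path′ in path″ , flipStep⁺ path path″ (there change)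
... | _ , path′ , change@(there _) = let path″ = step px t edge path′ in path″ , flipStep⁺ path path″ (there change)

inFlipclass-cons : ∀ {n h} {x} {p q : PathV n h} → Path (x ∷ p) → InFlipclass p q → InFlipclass (x ∷ p) (x ∷ q)
inFlipclass-cons path ε = ε
inFlipclass-cons {p = p} path (_◅_ {j = r} flip rest) with flipStep-cons {p = p} {r} path flip
... | path′ , flip′ = flip′ ◅ inFlipclass-cons path′ rest

inFlipclass-tSet : ∀ {n h} {p q : PathV n h} → InFlipclass p q → ∀ {i x} → TSet p i x → TSet q i x
inFlipclass-tSet reach (r , reach′ , eq) = r , inFlipclass-sym reach ◅◅ reach′ , eq

inFlipclass-incSet : ∀ {n h} (O : ReflectionOrdering n) {p q r : PathV n h} → InFlipclass p q → IncSet O p r → IncSet O q r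
inFlipclass-incSet O reach (reach′ , inc) = inFlipclass-sym reach ◅◅ reach′ , inc

-- The finite models and the computation.

-- Plain boolean tests keep the evaluation cheap; `IsEqual` supplies their correctness.
eqFin : ∀ {k} → Fin k → Fin k → Bool
eqFin zero    zero    = true
eqFin (suc i) (suc j) = eqFin i j
eqFin _       _       = false

ltFin : ∀ {k} → Fin k → Fin k → Bool
ltFin zero    (suc _) = true
ltFin (suc i) (suc j) = ltFin i j
ltFin _       _       = false

eqVec : ∀ {A : Set} {h} → (A → A → Bool) → Vec A h → Vec A h → Bool
eqVec eq []       []       = true
eqVec eq (x ∷ xs) (y ∷ ys) = eq x y ∧ eqVec eq xs ys

member : ∀ {A : Set} → (A → A → Bool) → A → List A → Bool
member eq x []       = false
member eq x (y ∷ ys) = eq x y ∨ member eq x ys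

Label : ℕ → Set
Label k = Fin k × Fin k

eqLabel : ∀ {k} → Label k → Label k → Bool
eqLabel (a , b) (c , d) = eqFin a c ∧ eqFin b d

-- A state records, for every value i of the model, the rank of the position of i within its block.
State : ℕ → Set
State k = Vec (Fin k) k

eqState : ∀ {k} → State k → State k → Bool
eqState = eqVec eqFin

rises : ∀ {k} → State k → Label k → Bool
rises σ (i , j) = ltFin (lookup σ i) (lookup σ j)

-- A state lists positions by value, so swapping the values i and j exchanges two entries.
exchange : ∀ {k} → Label k → State k → State k
exchange (i , j) σ = (σ [ i ]≔ lookup σ j) [ j ]≔ lookup σ i

orient : ∀ {k} → Fin k → Fin k → Label k
orient x y = if ltFin x y then (x , y) else (y , x)

conjugateBy : ∀ {k} → Label k → Label k → Label k
conjugateBy (c , d) (a , b) = orient (transpose c d a) (transpose c d b)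

Labels : ℕ → ℕ → Set
Labels k h = Vec (Label k) h

eqLabels : ∀ {k h} → Labels k h → Labels k h → Bool
eqLabels = eqVec eqLabel

run : ∀ {k h} → State k → Labels k h → Vec (State k) (suc h)
run σ []       = σ ∷ []
run σ (l ∷ ls) = σ ∷ run (exchange l σ) ls

-- τ is the state to which l, m lead from σ.
flipTo : ∀ {k h} → State k → State k → Label k → Label k → Label k → Labels k h →
  List (Labels k (2 + h)) → List (Labels k (2 + h))
flipTo σ τ l x y ls rest =
  if not (eqLabel x l) ∧ rises σ x ∧ rises (exchange x σ) y ∧ eqState (exchange y (exchange x σ)) τ
  then (x ∷ y ∷ ls) ∷ rest else rest

-- For n = m l m the product m l equals n m, and l n unless l and m commute; so the flip of (l , m) is
-- (m , n) or (n , l).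
flipsAtHead : ∀ {k h} → State k → State k → Label k → Label k → Label k → Labels k h →
  List (Labels k (2 + h)) → List (Labels k (2 + h))
flipsAtHead σ τ l m n ls rest = flipTo σ τ l m n ls (flipTo σ τ l n l ls rest)

flips : ∀ {k h} → State k → Labels k h → List (Labels k h)
flips σ []           = []
flips σ (l ∷ [])     = []
flips σ (l ∷ m ∷ ls) = flipsAtHead σ (exchange m (exchange l σ)) l m (conjugateBy m l) ls
  (map (l ∷_) (flips (exchange l σ) (m ∷ ls)))

module Search {A : Set} (eq : A → A → Bool) (next : A → List A) where

  visit : List A → List A → List A → List A × List A
  visit []       seen todo = seen , todo
  visit (x ∷ xs) seen todo = if member eq x seen then visit xs seen todo else visit xs (x ∷ seen) (x ∷ todo)

  search : ℕ → List A × List A → List A × List A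
  search zero    st                = st
  search (suc f) (seen , [])       = seen , []
  search (suc f) (seen , x ∷ todo) = search f (visit (next x) seen todo)

insert : ∀ {A : Set} → (A → A → Bool) → A → List A → List A
insert eq x ys = if member eq x ys then ys else x ∷ ys

nub : ∀ {A : Set} → (A → A → Bool) → List A → List A
nub eq []       = []
nub eq (x ∷ xs) = insert eq x (nub eq xs)

column : ∀ {A : Set} {h} → List (Vec A h) → Fin h → List A
column rows i = map (λ row → lookup row i) rows

levelSizes : ∀ {k h} → List (Vec (State k) h) → Vec ℕ h
levelSizes rows = Vec.tabulate (λ i → length (nub eqState (column rows i)))

tVector : ∀ {k h} → State k → List (Labels k h) → Vec ℕ (suc h)
tVector σ C = levelSizes (map (run σ) C)

-- The leaves of the tree are the reflection orderings of the model, listed from the least label on.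
data OrderTree : Set where
  node : List (ℕ × OrderTree) → OrderTree

Triple : Set
Triple = ℕ × ℕ × ℕ

memberℕ : ℕ → List ℕ → Bool
memberℕ = member _≡ᵇ_

-- For x = (a , b), y = (a , c), z = (b , c) a reflection ordering puts y between x and z;
-- the labels not in rem have been chosen before.
canBeLeast : List Triple → ℕ → List ℕ → Bool
canBeLeast []                  s rem = true
canBeLeast ((x , y , z) ∷ trs) s rem =
  (if s ≡ᵇ y then not (memberℕ x rem ∧ memberℕ z rem) else
   if s ≡ᵇ x then not (memberℕ y rem) ∨ memberℕ z rem else
   if s ≡ᵇ z then not (memberℕ y rem) ∨ memberℕ x rem else true) ∧ canBeLeast trs s rem

delete : ℕ → List ℕ → List ℕ
delete s = filterᵇ (λ x → not (s ≡ᵇ x))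

orderTree : List Triple → ℕ → List ℕ → OrderTree
branches : List Triple → ℕ → List ℕ → List ℕ → List (ℕ × OrderTree)
orderTree trs zero    rem = node []
orderTree trs (suc f) rem = node (branches trs f rem rem)
branches trs f rem []       = []
branches trs f rem (s ∷ ss) =
  if canBeLeast trs s rem then (s , orderTree trs f (delete s rem)) ∷ branches trs f rem ss else branches trs f rem ss

-- pending: what remains, of length at least 2, of the sequences that may still turn out to increase.
record Tally : Set where
  constructor tally
  field
    found : ℕ
    pending : List (List ℕ)

addFound : Tally → Tally
addFound (tally a qs) = tally (suc a) qs

addOpen : List ℕ → Tally → Tally
addOpen q (tally a qs) = tally a (q ∷ qs)

addRemainder : List ℕ → Tally → Tally
addRemainder q@(_ ∷ _ ∷ _) = addOpen q
addRemainder _             = addFound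

-- A sequence that contains the least label s anywhere but in front does not increase.
removeLeast : ℕ → List (List ℕ) → ℕ → Tally
removeLeast s []             a = tally a []
removeLeast s ([] ∷ qs)      a = addFound (removeLeast s qs a)
removeLeast s ((x ∷ q) ∷ qs) a =
  if memberℕ s q then removeLeast s qs a else
  if s ≡ᵇ x then addRemainder q (removeLeast s qs a) else addOpen (x ∷ q) (removeLeast s qs a)

-- A branch is left as soon as nothing is pending: all orderings below it then give the same count.
countsTo : ℕ → OrderTree → Tally → Bool
allCountTo : ℕ → List (ℕ × OrderTree) → ℕ → List (List ℕ) → Bool
countsTo c t                (tally a [])         = a ≡ᵇ c
-- On an empty node `allCountTo` would hold vacuously, so it has to fail here; exhausted fuel is
-- caught in the same way.
countsTo c (node [])        (tally a (_ ∷ _))    = false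
countsTo c (node (st ∷ ts)) (tally a qs@(_ ∷ _)) = allCountTo c (st ∷ ts) a qs
allCountTo c []             a qs = true
allCountTo c ((s , t) ∷ ts) a qs = countsTo c t (removeLeast s qs a) ∧ allCountTo c ts a qs

-- An injective numbering whose natural order is the lexicographic ordering of the labels, itself a
-- reflection ordering.
code : ∀ {k} → Label k → ℕ
code {k} (a , b) = k * toℕ a + toℕ b

codes : ∀ {k h} → Labels k h → List ℕ
codes []       = []
codes (l ∷ ls) = code l ∷ codes ls

sameBlock : ∀ {k} → Vec ℕ k → Fin k → Fin k → Bool
sameBlock bs i j = lookup bs i ≡ᵇ lookup bs j

isLabel : ∀ {k} → Vec ℕ k → Label k → Bool
isLabel bs (i , j) = ltFin i j ∧ sameBlock bs i j

allLabels : ∀ {k} → Vec ℕ k → List (Label k)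
allLabels {k} bs = filterᵇ (isLabel bs) (cartesianProduct (allFin k) (allFin k))

triples : ∀ {k} → List (Label k) → List Triple
triples ls = concatMap (λ (i , j) → concatMap (λ (j′ , l) →
  if eqFin j j′ then (code (i , j) , code (i , l) , code (j , l)) ∷ [] else []) ls) ls

arrangements : ∀ {k h} → Vec (List (Fin k)) h → List (Fin k) → List (Vec (Fin k) h)
arrangements []       used = [] ∷ []
arrangements (A ∷ As) used = concatMap
  (λ a → if member eqFin a used then [] else map (a ∷_) (arrangements As (a ∷ used))) A

-- The elements of the product of the symmetric groups on the blocks.
allStates : ∀ {k} → Vec ℕ k → List (State k)
allStates {k} bs = arrangements (Vec.tabulate (λ i → filterᵇ (sameBlock bs i) (allFin k))) []

increasingPaths : ∀ {k} → List (Label k) → (h : ℕ) → ℕ → State k → List (Labels k h)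
increasingPaths ls zero    b σ = [] ∷ []
increasingPaths ls (suc h) b σ = concatMap (λ l → if (b ℕ.≤ᵇ code l) ∧ rises σ l
  -- The strict bound loses nothing: a label repeated at once leads back down.
  then map (l ∷_) (increasingPaths ls h (suc (code l)) (exchange l σ)) else []) ls

every : ∀ {A : Set} → (A → Bool) → List A → Bool
every p []       = true
every p (x ∷ xs) = p x ∧ every p xs

some : ∀ {A : Set} → (A → Bool) → List A → Bool
some p []       = false
some p (x ∷ xs) = p x ∨ some p xs

-- The rank two fact behind `straighten`, established by evaluation: a descent l, m flips to a pair
-- with a smaller first label.
descentFlips : ∀ {k} → State k → Label k → Label k → Bool
descentFlips σ l m = if (code m ℕ.≤ᵇ code l) ∧ rises σ l ∧ rises (exchange l σ) m
  then some (λ q → code (Vec.head q) ℕ.<ᵇ code l) (flips σ (l ∷ m ∷ [])) else true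

descentsFlip : ∀ {k} → List (Label k) → State k → Bool
descentsFlip ls σ = every (λ l → every (descentFlips σ l) ls) ls

-- The target depends on the t-vector alone and is the same on all branches, so independence of the
-- ordering is part of what is tested.
checkClass : ∀ {k} → OrderTree → State k → List (Labels k 4) → Bool
checkClass tree σ C = countsTo (cFormula (tVector σ C)) tree (tally 0 (map codes C))

-- The fuel 100 suffices: a flipclass of a model has at most 56 paths.
checkPaths : ∀ {k} → ℕ → OrderTree → State k → List (Labels k 4) → Bool
checkPaths′ : ∀ {k} → ℕ → OrderTree → State k → List (Labels k 4) → List (Labels k 4) × List (Labels k 4) → Bool
checkPaths zero    tree σ _        = false
checkPaths (suc f) tree σ []       = true
checkPaths (suc f) tree σ (q ∷ qs) =
  checkPaths′ f tree σ qs (Search.search eqLabels (flips σ) 100 (q ∷ [] , q ∷ []))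
checkPaths′ f tree σ qs (C , [])    =
  checkClass tree σ C ∧ checkPaths f tree σ (filterᵇ (λ q → not (member eqLabels q C)) qs)
checkPaths′ f tree σ qs (C , _ ∷ _) = false

checkStates : ∀ {k} → List (Label k) → OrderTree → List (State k) → Bool
checkStates ls tree []       = true
checkStates ls tree (σ ∷ σs) =
  descentsFlip ls σ ∧ checkPaths 100 tree σ (increasingPaths ls 4 0 σ) ∧ checkStates ls tree σs

checkLabels : ∀ {k} → Vec ℕ k → List (Label k) → Bool
checkLabels bs ls = checkStates ls (orderTree (triples ls) (length ls) (map code ls)) (allStates bs)

checkBlocks : ∀ {k} → Vec ℕ k → Bool
checkBlocks bs = checkLabels bs (allLabels bs)

-- A block is identified by the number of blocks after it. Its identifier thus exceeds all later
-- ones, which keeps blocks apart (`blockIds-bound`).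
blockIds : (ss : List ℕ) → Vec ℕ (sum ss)
blockIds []       = []
blockIds (s ∷ ss) = Vec.replicate s (length ss) Vec.++ blockIds ss

incrementHead : List ℕ → List ℕ
incrementHead []       = []
incrementHead (s ∷ ss) = suc s ∷ ss

-- A unit of the sum of all s - 1 either opens a new block of size 2 or enlarges the first block.
-- All orders of the sizes occur, and the empty list recurs.
blockSizes : ℕ → List (List ℕ)
blockSizes zero    = [] ∷ []
blockSizes (suc m) = [] ∷ map (2 ∷_) (blockSizes m) ++ map incrementHead (blockSizes m)

checkAll : List (List ℕ) → Bool
checkAll []         = true
checkAll (ss ∷ sss) = checkBlocks (blockIds ss) ∧ checkAll sss

-- Correctness of the tests and operations on states and labels.

ltFin⁻ : ∀ {k} (i j : Fin k) → ltFin i j ≡ true → i Fin.< j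
ltFin⁻ zero    (suc j) _ = s≤s z≤n
ltFin⁻ (suc i) (suc j) p = s≤s (ltFin⁻ i j p)

ltFin⁺ : ∀ {k} {i j : Fin k} → i Fin.< j → ltFin i j ≡ true
ltFin⁺ {i = zero}  {suc j} _         = refl
ltFin⁺ {i = suc i} {suc j} (s≤s i<j) = ltFin⁺ i<j

record IsEqual {A : Set} (eq : A → A → Bool) : Set where
  field
    eq⁻ : ∀ x y → eq x y ≡ true → x ≡ y
    eq⁺ : ∀ x → eq x x ≡ true

  eq-false : ∀ x y → x ≢ y → eq x y ≡ false
  eq-false x y x≢y with eq x y in p
  ... | true  = ⊥-elim (x≢y (eq⁻ x y p))
  ... | false = refl

  member⁻ : ∀ x xs → member eq x xs ≡ true → x ∈ xs
  member⁻ x (y ∷ ys) p with eq x y in q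
  ... | true  = here (eq⁻ x y q)
  ... | false = there (member⁻ x ys p)

  member⁺ : ∀ {x xs} → x ∈ xs → member eq x xs ≡ true
  member⁺ {x} {y ∷ ys} (here refl) rewrite eq⁺ x = refl
  member⁺ {x} {y ∷ ys} (there x∈ys) with eq x y
  ... | true  = refl
  ... | false = member⁺ x∈ys

open IsEqual

eqFin-isEqual : ∀ {k} → IsEqual (eqFin {k})
eqFin-isEqual = record { eq⁻ = sound ; eq⁺ = complete }
  where
  sound : ∀ {k} (i j : Fin k) → eqFin i j ≡ true → i ≡ j
  sound zero    zero    _ = refl
  sound (suc i) (suc j) p = cong suc (sound i j p)
  complete : ∀ {k} (i : Fin k) → eqFin i i ≡ true
  complete zero    = refl
  complete (suc i) = complete i

eqLabel-isEqual : ∀ {k} → IsEqual (eqLabel {k})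
eqLabel-isEqual = record
  { eq⁻ = λ (a , b) (c , d) p → cong₂ _,_ (eq⁻ eqFin-isEqual a c (proj₁ (∧-true⁻ p))) (eq⁻ eqFin-isEqual b d (proj₂ (∧-true⁻ p)))
  ; eq⁺ = λ (a , b) → cong₂ _∧_ (eq⁺ eqFin-isEqual a) (eq⁺ eqFin-isEqual b) }

eqVec-isEqual : ∀ {A : Set} {h} {eq : A → A → Bool} → IsEqual eq → IsEqual (eqVec {h = h} eq)
eqVec-isEqual {A} {eq = eq} isEq = record { eq⁻ = sound ; eq⁺ = complete }
  where
  sound : ∀ {h} (xs ys : Vec A h) → eqVec eq xs ys ≡ true → xs ≡ ys
  sound []       []       _ = refl
  sound (x ∷ xs) (y ∷ ys) p = cong₂ _∷_ (eq⁻ isEq x y (proj₁ (∧-true⁻ p))) (sound xs ys (proj₂ (∧-true⁻ p)))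
  complete : ∀ {h} (xs : Vec A h) → eqVec eq xs xs ≡ true
  complete []       = refl
  complete (x ∷ xs) = cong₂ _∧_ (eq⁺ isEq x) (complete xs)

T⇒true : ∀ {b} → T b → b ≡ true
T⇒true {true} _ = refl

≡ᵇ-isEqual : IsEqual _≡ᵇ_
≡ᵇ-isEqual = record
  { eq⁻ = λ m n p → ℕₚ.≡ᵇ⇒≡ m n (subst T (sym p) tt)
  ; eq⁺ = λ n → T⇒true (ℕₚ.≡⇒≡ᵇ n n refl) }

lookup-exchange : ∀ {k} (a b : Fin k) (σ : State k) i → lookup (exchange (a , b) σ) i ≡ lookup σ (transpose a b i)
lookup-exchange a b σ i with transposeView a b i
... | right = trans (Vecₚ.lookup∘update b (σ [ a ]≔ lookup σ b) (lookup σ a)) (cong (lookup σ) (sym (transpose-right a b)))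
... | fixed i≢a i≢b = trans (Vecₚ.lookup∘update′ i≢b (σ [ a ]≔ lookup σ b) (lookup σ a))
  (trans (Vecₚ.lookup∘update′ i≢a σ (lookup σ b)) (cong (lookup σ) (sym (transpose-fixed a b i≢a i≢b))))
... | left with a Finₚ.≟ b
...   | yes refl = trans (Vecₚ.lookup∘update a (σ [ a ]≔ lookup σ a) (lookup σ a)) (cong (lookup σ) (sym (transpose-left a a)))
...   | no a≢b = trans (Vecₚ.lookup∘update′ a≢b (σ [ a ]≔ lookup σ b) (lookup σ a))
  (trans (Vecₚ.lookup∘update a σ (lookup σ b)) (cong (lookup σ) (sym (transpose-left a b))))

IsLabel : ∀ {k} → Vec ℕ k → Label k → Set
IsLabel bs (a , b) = a Fin.< b × lookup bs a ≡ lookup bs b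

lookup-transpose : ∀ {k} (bs : Vec ℕ k) {a b} → lookup bs a ≡ lookup bs b → ∀ i → lookup bs (transpose a b i) ≡ lookup bs i
lookup-transpose bs {a} {b} same i with transposeView a b i
... | left          = trans (cong (lookup bs) (transpose-left a b)) (sym same)
... | right         = trans (cong (lookup bs) (transpose-right a b)) same
... | fixed i≢a i≢b = cong (lookup bs) (transpose-fixed a b i≢a i≢b)

orient-isLabel : ∀ {k} (bs : Vec ℕ k) {a b} → a ≢ b → lookup bs a ≡ lookup bs b → IsLabel bs (orient a b)
orient-isLabel bs {a} {b} a≢b same with ltFin a b in p
... | true  = ltFin⁻ a b p , same
... | false with Finₚ.<-cmp a b
...   | tri< a<b _ _ = false≢true (trans (sym p) (ltFin⁺ a<b))
...   | tri≈ _ a≡b _ = ⊥-elim (a≢b a≡b)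
...   | tri> _ _ b<a = b<a , sym same

conjugateBy-isLabel : ∀ {k} (bs : Vec ℕ k) {l m} → IsLabel bs l → IsLabel bs m → IsLabel bs (conjugateBy m l)
conjugateBy-isLabel bs {a , b} {c , d} (a<b , a~b) (_ , c~d) = orient-isLabel bs
  (λ eq → Finₚ.<-irrefl (transpose-injective c d eq) a<b)
  (trans (lookup-transpose bs c~d a) (trans a~b (sym (lookup-transpose bs c~d b))))

-- Copies of a model in the symmetric group.

data Ascending {k} (bs : Vec ℕ k) : ∀ {h} → State k → Labels k h → Set where
  []  : ∀ {σ} → Ascending bs σ []
  cons : ∀ {h σ l} {ls : Labels k h} → IsLabel bs l → rises σ l ≡ true → Ascending bs (exchange l σ) ls → Ascending bs σ (l ∷ ls)

-- A copy of the model in S_n: e and r list the values and the positions of the blocks.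
record Embedding {n k} (u : Word n) (bs : Vec ℕ k) : Set where
  field
    e r         : Fin k → Fin n
    e-injective : ∀ {i j} → e i ≡ e j → i ≡ j
    r-injective : ∀ {i j} → r i ≡ r j → i ≡ j
    e-mono      : ∀ {i j} → i Fin.< j → lookup bs i ≡ lookup bs j → e i Fin.< e j
    r-mono      : ∀ {i j} → i Fin.< j → lookup bs i ≡ lookup bs j → r i Fin.< r j

  -- x is the word that has state σ in the copy. `on` places the values in blocks and `off` leaves
  -- the others as in u, so σ determines x; `block` makes `r-mono` applicable to the ranks listed in
  -- σ.
  record Tracks (x : Word n) (σ : State k) : Set where
    field
      perm  : IsPerm x
      on    : ∀ i → lookup x (r (lookup σ i)) ≡ e i
      off   : ∀ j → (∀ i → lookup x j ≢ e i) → lookup u j ≡ lookup x j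
      block : ∀ i → lookup bs (lookup σ i) ≡ lookup bs i

  open Tracks

  act : Label k → Word n → Word n
  act (a , b) = swapValues (e a) (e b)

  toTransp : (l : Label k) → IsLabel bs l → Transp n
  toTransp (a , b) (a<b , a~b) = tr (e a) (e b) (e-mono a<b a~b)

  e-transpose : ∀ a b i → e (transpose a b i) ≡ transpose (e a) (e b) (e i)
  e-transpose = transpose-natural e e-injective

  tracks-exchange : ∀ {x σ} l → IsLabel bs l → Tracks x σ → Tracks (act l x) (exchange l σ)
  tracks-exchange {x} {σ} l@(a , b) (_ , a~b) tracks = record
    { perm = swapValues-perm (e a) (e b) x (perm tracks)
    ; on = λ i → trans (cong (lookup (act l x) ∘ r) (lookup-exchange a b σ i)) (trans (Vecₚ.lookup-map _ _ x)
        (trans (cong (transpose (e a) (e b)) (on tracks (transpose a b i))) (trans (sym (e-transpose a b _)) (cong e (transpose-involutive a b i)))))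
    ; off = λ j miss → trans (off tracks j (λ i eq → miss (transpose a b i)
          (trans (Vecₚ.lookup-map j _ x) (trans (cong (transpose (e a) (e b)) eq) (sym (e-transpose a b i))))))
        (sym (trans (Vecₚ.lookup-map j _ x) (transpose-fixed (e a) (e b)
          (λ eq → miss b (trans (Vecₚ.lookup-map j _ x) (trans (cong (transpose (e a) (e b)) eq) (transpose-left (e a) (e b)))))
          (λ eq → miss a (trans (Vecₚ.lookup-map j _ x) (trans (cong (transpose (e a) (e b)) eq) (transpose-right (e a) (e b))))))))
    ; block = λ i → trans (cong (lookup bs) (lookup-exchange a b σ i)) (trans (block tracks (transpose a b i)) (lookup-transpose bs a~b i)) }

  -- A position where either word has a block value is the one that `on` prescribes for both;
  -- elsewhere both agree with u.
  tracks-wordUnique : ∀ {x y σ} → Tracks x σ → Tracks y σ → x ≡ y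
  tracks-wordUnique {x} {y} {σ} tx ty = Vec-ext agree
    where
    meets : ∀ {x} → Tracks x σ → ∀ j i → lookup x j ≡ e i → j ≡ r (lookup σ i)
    meets t j i eq = perm t j _ (trans eq (sym (on t i)))
    agree : ∀ j → lookup x j ≡ lookup y j
    agree j with Finₚ.any? (λ i → lookup x j Finₚ.≟ e i) | Finₚ.any? (λ i → lookup y j Finₚ.≟ e i)
    ... | yes (i , eq) | _ = trans eq (sym (trans (cong (lookup y) (meets tx j i eq)) (on ty i)))
    ... | no _ | yes (i , eq) = sym (trans eq (sym (trans (cong (lookup x) (meets ty j i eq)) (on tx i))))
    ... | no ¬x | no ¬y = trans (sym (off tx j (λ i eq → ¬x (i , eq)))) (off ty j (λ i eq → ¬y (i , eq)))

  tracks-stateUnique : ∀ {x σ τ} → Tracks x σ → Tracks x τ → σ ≡ τ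
  tracks-stateUnique tσ tτ = Vec-ext (λ i → r-injective (perm tσ _ _ (trans (on tσ i) (sym (on tτ i)))))

  rises⇒longer : ∀ {x σ} l → IsLabel bs l → Tracks x σ → rises σ l ≡ true → len x ℕ.< len (act l x)
  rises⇒longer {x} {σ} (a , b) (a<b , a~b) tracks rising = len-swapValues x (perm tracks) (on tracks a) (on tracks b)
    (r-mono (ltFin⁻ (lookup σ a) (lookup σ b) rising) (trans (block tracks a) (trans a~b (sym (block tracks b))))) (e-mono a<b a~b)

  longer⇒rises : ∀ {x σ} l → IsLabel bs l → Tracks x σ → len x ℕ.< len (act l x) → rises σ l ≡ true
  longer⇒rises {x} {σ} (a , b) (a<b , a~b) tracks longer with Finₚ.<-cmp (lookup σ a) (lookup σ b)
    | len-swapValues⁻ x (perm tracks) (on tracks a) (on tracks b) (e-mono a<b a~b) longer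
  ... | tri< σa<σb _ _ | _ = ltFin⁺ σa<σb
  ... | tri≈ _ σa≡σb _ | ra<rb = ⊥-elim (Finₚ.<-irrefl (cong r σa≡σb) ra<rb)
  ... | tri> _ _ σb<σa | ra<rb = ⊥-elim (Finₚ.<-asym ra<rb
      (r-mono σb<σa (trans (block tracks b) (trans (sym a~b) (sym (block tracks a))))))

  steps : ∀ {h} → Word n → Labels k h → Vec (Word n) h
  steps x []       = []
  steps x (l ∷ ls) = act l x ∷ steps (act l x) ls

  decode : ∀ {h} → Word n → Labels k h → PathV n h
  decode x ls = x ∷ steps x ls

  decode-path : ∀ {h x σ} {ls : Labels k h} → Tracks x σ → Ascending bs σ ls → Path (decode x ls)
  decode-path tracks [] = end (perm tracks)
  decode-path tracks (cons {l = l} isL rising asc) = step (perm tracks) (toTransp l isL)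
    (refl , rises⇒longer l isL tracks rising) (decode-path (tracks-exchange l isL tracks) asc)

  decode-tracks : ∀ {h x σ} {ls : Labels k h} → Tracks x σ → Ascending bs σ ls →
    ∀ i → Tracks (lookup (decode x ls) i) (lookup (run σ ls) i)
  decode-tracks tracks [] zero = tracks
  decode-tracks tracks (cons isL rising asc) zero = tracks
  decode-tracks tracks (cons {l = l} isL rising asc) (suc i) = decode-tracks (tracks-exchange l isL tracks) asc i

  act-injective : ∀ {x} → IsPerm x → ∀ {l m} → IsLabel bs l → IsLabel bs m → act l x ≡ act m x → l ≡ m
  act-injective {x} px {l} {m} isL isM eq with label-unique x px {toTransp l isL} {toTransp m isM} eq
  ... | eqT = cong₂ _,_ (e-injective (cong Transp.a eqT)) (e-injective (cong Transp.b eqT))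

  decode-injective : ∀ {h x σ} {ls ms : Labels k h} → Tracks x σ → Ascending bs σ ls → Ascending bs σ ms →
    decode x ls ≡ decode x ms → ls ≡ ms
  decode-injective tracks [] [] eq = refl
  decode-injective tracks (cons {l = l} isL _ asc) (cons {l = m} isM _ asc′) eq
    with act-injective (perm tracks) isL isM (cong (Vec.head ∘ Vec.tail) eq)
  ... | refl = cong (l ∷_) (decode-injective (tracks-exchange l isL tracks) asc asc′ (cong Vec.tail eq))

  IsImage : Transp n → Set
  IsImage t = ∃ λ l → Σ (IsLabel bs l) λ isL → toTransp l isL ≡ t

  -- That the labels rise is read off from the lengths by `longer⇒rises`; hence it suffices that
  -- they come from the model.
  encode : ∀ {h x σ} {ys : Vec (Word n) h} → Tracks x σ → (path : Path (x ∷ ys)) →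
    VecAll.All IsImage (labels path) → ∃ λ ls → Ascending bs σ ls × x ∷ ys ≡ decode x ls
  encode tracks (end _) _ = [] , [] , refl
  encode {x = x} tracks (step _ t (refl , longer) path) ((l , isL , refl) VecAll.∷ images)
    with encode (tracks-exchange l isL tracks) path images
  ... | ls , asc , eq = l ∷ ls , cons isL (longer⇒rises l isL tracks longer) asc , cong (x ∷_) eq

  swapValues-orient : ∀ a b x → act (orient a b) x ≡ swapValues (e a) (e b) x
  swapValues-orient a b x with ltFin a b
  ... | true  = refl
  ... | false = Vecₚ.map-cong (transpose-comm (e b) (e a)) x

  swapValues-samePair : ∀ {a b c d : Fin n} → SamePair a b c d → ∀ x → swapValues a b x ≡ swapValues c d x
  swapValues-samePair (inj₁ (refl , refl)) x = refl
  swapValues-samePair (inj₂ (refl , refl)) x = Vecₚ.map-cong (transpose-comm _ _) x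

  act-conjugateBy : ∀ m l x → act (conjugateBy m l) x ≡ swapValues (e (transpose (proj₁ m) (proj₂ m) (proj₁ l))) (e (transpose (proj₁ m) (proj₂ m) (proj₂ l))) x
  act-conjugateBy (c , d) (a , b) x = swapValues-orient (transpose c d a) (transpose c d b) x

  -- The factorisation m l = (m l m) m: `transpose-natural` for the transposition m.
  conjugateBy-act : ∀ m l x → act (conjugateBy m l) (act m x) ≡ act m (act l x)
  conjugateBy-act m@(c , d) l@(a , b) x = trans (act-conjugateBy m l (act m x)) (trans (sym (Vecₚ.map-∘ _ _ x)) (trans (Vecₚ.map-cong pointwise x) (Vecₚ.map-∘ _ _ x)))
    where
    pointwise : ∀ v → transpose (e (transpose c d a)) (e (transpose c d b)) (transpose (e c) (e d) v) ≡ transpose (e c) (e d) (transpose (e a) (e b) v)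
    pointwise v = trans (cong₂ (λ v₁ v₂ → transpose v₁ v₂ (transpose (e c) (e d) v)) (e-transpose c d a) (e-transpose c d b))
      (sym (transpose-natural (transpose (e c) (e d)) (transpose-injective (e c) (e d)) (e a) (e b) v))

  ∈-flipTo-rest : ∀ {h} σ τ l x y (ls : Labels k h) {rest q} → q ∈ rest → q ∈ flipTo σ τ l x y ls rest
  ∈-flipTo-rest σ τ l x y ls q∈ with not (eqLabel x l) ∧ rises σ x ∧ rises (exchange x σ) y ∧ eqState (exchange y (exchange x σ)) τ
  ... | true  = there q∈
  ... | false = q∈

  IsFlipTo : State k → State k → Label k → Label k → Label k → Set
  IsFlipTo σ τ l x y = x ≢ l × rises σ x ≡ true × rises (exchange x σ) y ≡ true × exchange y (exchange x σ) ≡ τ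

  ∈-flipTo⁺ : ∀ {h} σ τ l x y (ls : Labels k h) {rest} → IsFlipTo σ τ l x y → (x ∷ y ∷ ls) ∈ flipTo σ τ l x y ls rest
  ∈-flipTo⁺ σ τ l x y ls (x≢l , up , up′ , refl)
    rewrite eq-false eqLabel-isEqual x l x≢l | up | up′ | eq⁺ (eqVec-isEqual eqFin-isEqual) (exchange y (exchange x σ)) = here refl

  ∈-flipTo⁻ : ∀ {h} σ τ l x y (ls : Labels k h) {rest q} → q ∈ flipTo σ τ l x y ls rest → (q ≡ x ∷ y ∷ ls × IsFlipTo σ τ l x y) ⊎ q ∈ rest
  ∈-flipTo⁻ σ τ l x y ls {rest} q∈ with eqLabel x l in xl | rises σ x in up | rises (exchange x σ) y in up′ | eqState (exchange y (exchange x σ)) τ in end′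
  ... | true  | _ | _ | _ = inj₂ q∈
  ... | false | false | _ | _ = inj₂ q∈
  ... | false | true | false | _ = inj₂ q∈
  ... | false | true | true | false = inj₂ q∈
  ∈-flipTo⁻ σ τ l x y ls (there q∈) | false | true | true | true = inj₂ q∈
  ∈-flipTo⁻ σ τ l x y ls (here eq) | false | true | true | true = inj₁ (eq ,
    (λ where refl → false≢true (trans (sym xl) (eq⁺ eqLabel-isEqual x))) , refl , refl , eq⁻ (eqVec-isEqual eqFin-isEqual) _ τ end′)

  -- The new middle vertex y yields a second factorisation of m l, and `firstFactor` leaves only the
  -- candidates tried by `flipsAtHead`. The tests of `flipTo` succeed because the lengths grow along
  -- the given path and its end is z.
  flips-complete : ∀ {h x σ} {ls : Labels k h} {q} → Tracks x σ → Ascending bs σ ls → Path q →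
    OneInnerChange (decode x ls) q → ∃ λ ms → ms ∈ flips σ ls × q ≡ decode x ms
  flips-complete {x = x} {σ} {l ∷ m ∷ ls} tracks (cons isL up (cons isM up′ asc))
    (step _ (tr a′ b′ a′<b′) (y≡ , y-longer) (step {x = y} _ (tr c′ d′ c′<d′) (z≡ , z-longer) _)) (here differs) = result
    where
    z : Word n
    z = act m (act l x)
    τ : State k
    τ = exchange m (exchange l σ)
    nₗ : Label k
    nₗ = conjugateBy m l
    isN : IsLabel bs nₗ
    isN = conjugateBy-isLabel bs isL isM
    tz : Tracks z τ
    tz = tracks-exchange m isM (tracks-exchange l isL tracks)
    found : ∀ v w → IsLabel bs v → IsLabel bs w → y ≡ act v x → act w (act v x) ≡ z → IsFlipTo σ τ l v w
    found v w isV isW y≡v z≡w = (λ where refl → differs (sym y≡v)) ,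
      longer⇒rises v isV tracks (subst (λ y → len x ℕ.< len y) y≡v y-longer) ,
      longer⇒rises w isW tv (subst₂ (λ y z → len y ℕ.< len z) y≡v (sym z≡w) z-longer) ,
      tracks-stateUnique (subst (λ z → Tracks z _) z≡w (tracks-exchange w isW tv)) tz
      where tv = tracks-exchange v isV tracks
    conclude : ∀ v w → y ≡ act v x → act w (act v x) ≡ z →
      (v ∷ w ∷ ls) ∈ flips σ (l ∷ m ∷ ls) → ∃ λ ms → ms ∈ flips σ (l ∷ m ∷ ls) × x ∷ y ∷ z ∷ steps z ls ≡ decode x ms
    conclude v w y≡v z≡w ∈flips = v ∷ w ∷ ls , ∈flips , cong₂ (λ y z → x ∷ y ∷ z ∷ steps z ls) y≡v (sym z≡w)
    -- If l and m were the same transposition, z would be x although the length has grown twice.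
    differ : ¬ SamePair (e (proj₁ l)) (e (proj₂ l)) (e (proj₁ m)) (e (proj₂ m))
    differ same = ℕₚ.<-irrefl (cong len (trans (sym (swapValues-involutive (e (proj₁ l)) (e (proj₂ l)) x)) (swapValues-samePair same (act l x))))
      (ℕₚ.<-trans (rises⇒longer l isL tracks up) (rises⇒longer m isM (tracks-exchange l isL tracks) up′))
    factor : FirstFactor (transpose (e (proj₁ l)) (e (proj₂ l))) (transpose (e (proj₁ m)) (e (proj₂ m)))
      (e (proj₁ l)) (e (proj₂ l)) (e (proj₁ m)) (e (proj₂ m)) a′ b′
    factor = firstFactor (transpose-isSwap _ _) (transpose-isSwap _ _) (transpose-isSwap a′ b′) (transpose-isSwap c′ d′)
      (λ eq → Finₚ.<-irrefl eq (e-mono (proj₁ isL) (proj₂ isL))) (λ eq → Finₚ.<-irrefl eq (e-mono (proj₁ isM) (proj₂ isM))) differ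
      (λ eq → Finₚ.<-irrefl eq a′<b′)
      (swapValues-pointwise x (perm tracks) _ _ (trans (Vecₚ.map-∘ _ _ x) (trans (cong (swapValues c′ d′) (sym y≡)) (trans (sym z≡) (sym (Vecₚ.map-∘ _ _ x))))))
    result : ∃ λ ms → ms ∈ flips σ (l ∷ m ∷ ls) × x ∷ y ∷ z ∷ steps z ls ≡ decode x ms
    result with factor
    ... | first same = ⊥-elim (differs (sym (trans y≡ (swapValues-samePair same x))))
    ... | second same = conclude m nₗ y≡m z≡n (∈-flipTo⁺ σ τ l m nₗ ls (found m nₗ isM isN y≡m z≡n))
      where
      y≡m = trans y≡ (swapValues-samePair same x)
      z≡n = conjugateBy-act m l x
    ... | conjugate same rotate = conclude nₗ l y≡n z≡l
        (∈-flipTo-rest σ τ l m nₗ ls (∈-flipTo⁺ σ τ l nₗ l ls (found nₗ l isN isL y≡n z≡l)))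
      where
      conj-swap : ∀ v → act nₗ v ≡ swapValues (transpose (e (proj₁ m)) (e (proj₂ m)) (e (proj₁ l))) (transpose (e (proj₁ m)) (e (proj₂ m)) (e (proj₂ l))) v
      conj-swap v = trans (act-conjugateBy m l v) (cong₂ (λ a b → swapValues a b v) (e-transpose _ _ _) (e-transpose _ _ _))
      y≡n = trans y≡ (trans (swapValues-samePair same x) (sym (conj-swap x)))
      z≡l : act l (act nₗ x) ≡ z
      z≡l = trans (cong (act l) (conj-swap x)) (trans (sym (Vecₚ.map-∘ _ _ x))
        (trans (Vecₚ.map-cong (rotate _ (transpose-isSwap _ _)) x) (Vecₚ.map-∘ _ _ x)))
  flips-complete {x = x} {σ} {l ∷ ls} tracks (cons isL up asc) (step _ _ _ path) (there change)
    with flips-complete (tracks-exchange l isL tracks) asc path change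
  ... | ms , ms∈ , refl = l ∷ ms , prepend ls ms∈ , refl
    where
    prepend : ∀ {h} (ls : Labels k h) {ms} → ms ∈ flips (exchange l σ) ls → (l ∷ ms) ∈ flips σ (l ∷ ls)
    prepend (m ∷ ls) ms∈ = ∈-flipTo-rest σ _ l m _ ls (∈-flipTo-rest σ _ l _ l ls (∈-map⁺ (l ∷_) ms∈))

  -- The test compares end states only; `tracks-wordUnique` makes the end words equal, so the rest
  -- of the path is unchanged.
  flipTo-sound : ∀ {h x σ l m} {ls : Labels k h} → Tracks x σ → Ascending bs σ (l ∷ m ∷ ls) →
    ∀ v w → IsLabel bs v → IsLabel bs w → IsFlipTo σ (exchange m (exchange l σ)) l v w →
    Ascending bs σ (v ∷ w ∷ ls) × OneInnerChange (decode x (l ∷ m ∷ ls)) (decode x (v ∷ w ∷ ls))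
  flipTo-sound {x = x} {l = l} {m} {ls} tracks (cons isL up (cons isM up′ asc)) v w isV isW (v≢l , upV , upW , eq) =
    cons isV upV (cons isW upW (subst (λ τ → Ascending bs τ ls) (sym eq) asc)) ,
    subst (λ z → OneInnerChange (decode x (l ∷ m ∷ ls)) (x ∷ act v x ∷ z ∷ steps z ls)) same-end
      (here (λ act≡ → v≢l (sym (act-injective (perm tracks) isL isV act≡))))
    where
    same-end : act m (act l x) ≡ act w (act v x)
    same-end = tracks-wordUnique (tracks-exchange m isM (tracks-exchange l isL tracks))
      (subst (Tracks _) eq (tracks-exchange w isW (tracks-exchange v isV tracks)))

  flips-sound : ∀ {h x σ} (ls : Labels k h) {ms} → Tracks x σ → Ascending bs σ ls → ms ∈ flips σ ls →
    Ascending bs σ ms × OneInnerChange (decode x ls) (decode x ms)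
  flips-sound {x = x} {σ} (l ∷ m ∷ ls) {ms} tracks asc@(cons isL up asc′@(cons isM _ _)) ms∈
    with ∈-flipTo⁻ σ _ l m _ ls ms∈
  ... | inj₁ (refl , flip) = flipTo-sound tracks asc m (conjugateBy m l) isM (conjugateBy-isLabel bs isL isM) flip
  ... | inj₂ ms∈′ with ∈-flipTo⁻ σ _ l (conjugateBy m l) l ls ms∈′
  ...   | inj₁ (refl , flip) = flipTo-sound tracks asc (conjugateBy m l) l (conjugateBy-isLabel bs isL isM) isL flip
  ...   | inj₂ ms∈″ with ∈-map⁻ (l ∷_) ms∈″
  ...     | ms′ , ms′∈ , refl with flips-sound (m ∷ ls) (tracks-exchange l isL tracks) asc′ ms′∈
  ...       | asc″ , change = cons isL up asc″ , there change

  -- A flip at the head ignores the tail, so it is enough to evaluate `descentsFlip` on pairs of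
  -- labels.
  flips-extend : ∀ {h} σ l m x y (ls : Labels k h) → (x ∷ y ∷ []) ∈ flips σ (l ∷ m ∷ []) → (x ∷ y ∷ ls) ∈ flips σ (l ∷ m ∷ ls)
  flips-extend σ l m x y ls xy∈ with ∈-flipTo⁻ σ (exchange m (exchange l σ)) l m (conjugateBy m l) [] xy∈
  ... | inj₁ (refl , flip) = ∈-flipTo⁺ σ _ l x y ls flip
  ... | inj₂ xy∈′ with ∈-flipTo⁻ σ (exchange m (exchange l σ)) l (conjugateBy m l) l [] xy∈′
  ...   | inj₁ (refl , flip) = ∈-flipTo-rest σ _ l m _ ls (∈-flipTo⁺ σ _ l x y ls flip)

-- Correctness of the search and of counting without repetition.

∈-filterᵇ⁺ : ∀ {A : Set} (p : A → Bool) {x xs} → x ∈ xs → p x ≡ true → x ∈ filterᵇ p xs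
∈-filterᵇ⁺ p x∈ px = ∈-filter⁺ (T? ∘ p) x∈ (subst T (sym px) tt)

∈-filterᵇ⁻ : ∀ {A : Set} (p : A → Bool) {x} xs → x ∈ filterᵇ p xs → x ∈ xs × p x ≡ true
∈-filterᵇ⁻ p xs x∈ with ∈-filter⁻ (T? ∘ p) {xs = xs} x∈
... | x∈xs , px = x∈xs , T⇒true px

module SearchProperties {A : Set} {eq : A → A → Bool} (isEq : IsEqual eq) (next : A → List A)
  (P : A → Set) (P-next : ∀ {x y} → P x → y ∈ next x → P y) where

  open Search eq next

  record Invariant (current : A → Set) (st : List A × List A) : Set where
    private
      seen = proj₁ st
      todo = proj₂ st
    field
      allP   : ∀ {x} → x ∈ seen → P x
      todo⊆  : todo ⊆ seen
      unique : Unique seen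
      closed : ∀ {x} → x ∈ seen → x ∈ todo ⊎ current x ⊎ next x ⊆ seen

  open Invariant

  visit-invariant : ∀ {current} xs {seen todo} → (∀ {x} → x ∈ xs → P x) → Invariant current (seen , todo) →
    Invariant current (visit xs seen todo) × seen ⊆ proj₁ (visit xs seen todo) × xs ⊆ proj₁ (visit xs seen todo)
  visit-invariant [] _ inv = inv , id , λ ()
  visit-invariant {current} (x ∷ xs) {seen} {todo} pxs inv with member eq x seen in p
  ... | true with visit-invariant xs (pxs ∘ there) inv
  ...   | inv′ , seen⊆ , xs⊆ = inv′ , seen⊆ , λ where
            (here refl) → seen⊆ (member⁻ isEq x seen p)
            (there y∈)  → xs⊆ y∈
  visit-invariant {current} (x ∷ xs) {seen} {todo} pxs inv | false with visit-invariant xs (pxs ∘ there) extended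
    where
    extended : Invariant current (x ∷ seen , x ∷ todo)
    extended = record
      { allP   = λ where (here refl) → pxs (here refl) ; (there y∈) → allP inv y∈
      ; todo⊆  = λ where (here refl) → here refl ; (there y∈) → there (todo⊆ inv y∈)
      ; unique = All.tabulate (λ y∈ x≡y → false≢true (trans (sym p) (subst (λ y → member eq y seen ≡ true) (sym x≡y) (member⁺ isEq y∈)))) ∷ unique inv
      ; closed = λ where
          (here refl) → inj₁ (here refl)
          (there y∈) → Sum.map there (Sum.map id (λ next⊆ {z} z∈ → there (next⊆ z∈))) (closed inv y∈) }
  ... | inv′ , seen⊆ , xs⊆ = inv′ , seen⊆ ∘ there , λ where
            (here refl) → seen⊆ (here refl)
            (there y∈)  → xs⊆ y∈

  search-invariant : ∀ f {st} → Invariant (λ _ → ⊥) st →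
    Invariant (λ _ → ⊥) (search f st) × proj₁ st ⊆ proj₁ (search f st)
  search-invariant zero inv = inv , id
  search-invariant (suc f) {seen , []} inv = inv , id
  search-invariant (suc f) {seen , x ∷ todo} inv with visit-invariant (next x) (P-next (allP inv (todo⊆ inv (here refl)))) started
    where
    started : Invariant (_≡ x) (seen , todo)
    started = record
      { allP = allP inv ; todo⊆ = todo⊆ inv ∘ there ; unique = unique inv
      ; closed = λ y∈ → classify (closed inv y∈) }
      where
      classify : ∀ {y} → y ∈ x ∷ todo ⊎ ⊥ ⊎ next y ⊆ seen → y ∈ todo ⊎ y ≡ x ⊎ next y ⊆ seen
      classify (inj₁ (here y≡x))    = inj₂ (inj₁ y≡x)
      classify (inj₁ (there y∈))    = inj₁ y∈
      classify (inj₂ (inj₂ next⊆))  = inj₂ (inj₂ next⊆)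
  ... | inv′ , seen⊆ , next⊆ with search-invariant f finished
    where
    finished : Invariant (λ _ → ⊥) (visit (next x) seen todo)
    finished = record { allP = allP inv′ ; todo⊆ = todo⊆ inv′ ; unique = unique inv′ ; closed = λ y∈ → classify (closed inv′ y∈) }
      where
      classify : ∀ {y} → y ∈ proj₂ (visit (next x) seen todo) ⊎ y ≡ x ⊎ next y ⊆ proj₁ (visit (next x) seen todo) →
        y ∈ proj₂ (visit (next x) seen todo) ⊎ ⊥ ⊎ next y ⊆ proj₁ (visit (next x) seen todo)
      classify (inj₁ y∈)           = inj₁ y∈
      classify (inj₂ (inj₁ refl))  = inj₂ (inj₂ next⊆)
      classify (inj₂ (inj₂ done))  = inj₂ (inj₂ done)
  ...   | inv″ , more = inv″ , more ∘ seen⊆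

  closure : ∀ f {x C} → P x → search f (x ∷ [] , x ∷ []) ≡ (C , []) →
    x ∈ C × Unique C × (∀ {y} → y ∈ C → P y) × (∀ {y z} → y ∈ C → z ∈ next y → z ∈ C)
  closure f {x} {C} px result = start⊆ (here refl) , unique inv , allP inv , λ y∈ → next-closed (closed inv y∈)
    where
    start : Invariant (λ _ → ⊥) (x ∷ [] , x ∷ [])
    start = record
      { allP = λ where (here refl) → px
      ; todo⊆ = id ; unique = [] ∷ [] ; closed = λ where (here refl) → inj₁ (here refl) }
    final : Invariant (λ _ → ⊥) (C , []) × x ∷ [] ⊆ C
    final = subst (λ st → Invariant (λ _ → ⊥) st × x ∷ [] ⊆ proj₁ st) result (search-invariant f start)
    inv = proj₁ final
    start⊆ = proj₂ final
    next-closed : ∀ {y} → y ∈ [] ⊎ ⊥ ⊎ next y ⊆ C → next y ⊆ C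
    next-closed (inj₂ (inj₂ next⊆)) = next⊆

module _ {A : Set} {eq : A → A → Bool} (isEq : IsEqual eq) where

  ∈-insert⁺ : ∀ {x y} ys → y ≡ x ⊎ y ∈ ys → y ∈ insert eq x ys
  ∈-insert⁺ {x} {y} ys y∈ with member eq x ys in p
  ∈-insert⁺ ys (inj₁ refl) | true  = member⁻ isEq _ _ p
  ∈-insert⁺ ys (inj₂ y∈)   | true  = y∈
  ∈-insert⁺ ys (inj₁ refl) | false = here refl
  ∈-insert⁺ ys (inj₂ y∈)   | false = there y∈

  ∈-insert⁻ : ∀ {x y ys} → y ∈ insert eq x ys → y ≡ x ⊎ y ∈ ys
  ∈-insert⁻ {x} {y} {ys} y∈ with member eq x ys
  ∈-insert⁻ y∈          | true  = inj₂ y∈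
  ∈-insert⁻ (here refl) | false = inj₁ refl
  ∈-insert⁻ (there y∈)  | false = inj₂ y∈

  ∈-nub⁺ : ∀ {y ys} → y ∈ ys → y ∈ nub eq ys
  ∈-nub⁺ {ys = x ∷ ys} (here refl) = ∈-insert⁺ (nub eq ys) (inj₁ refl)
  ∈-nub⁺ {ys = x ∷ ys} (there y∈)  = ∈-insert⁺ (nub eq ys) (inj₂ (∈-nub⁺ y∈))

  ∈-nub⁻ : ∀ {y} ys → y ∈ nub eq ys → y ∈ ys
  ∈-nub⁻ (x ∷ ys) y∈ with ∈-insert⁻ {x} {ys = nub eq ys} y∈
  ... | inj₁ refl = here refl
  ... | inj₂ y∈′  = there (∈-nub⁻ ys y∈′)

  -- Serves to count words through their states: f and g identify the same members of qs, so each
  -- distinct value of f contributes exactly one value of g.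
  image-size : ∀ {B C : Set} (f : B → A) (g : B → C) (qs : List B) →
    (∀ {p q} → p ∈ qs → q ∈ qs → (f p ≡ f q → g p ≡ g q) × (g p ≡ g q → f p ≡ f q)) →
    HasSize (λ x → ∃ λ q → q ∈ qs × g q ≡ x) (length (nub eq (map f qs)))
  image-size f g [] _ = [] , refl , [] , λ x → mk⇔ (λ ()) (λ ())
  image-size f g (q ∷ qs) agree with image-size f g qs (λ p∈ q∈ → agree (there p∈) (there q∈)) | member eq (f q) (nub eq (map f qs)) in p
  ... | L , len≡ , uniq , L⇔ | true = L , len≡ , uniq , λ x → mk⇔ to (Product.map id (Product.map there id) ∘ Equivalence.from (L⇔ x))
    where
    to : ∀ {x} → (∃ λ q′ → q′ ∈ q ∷ qs × g q′ ≡ x) → x ∈ L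
    to (q′ , there q′∈ , eq) = Equivalence.to (L⇔ _) (q′ , q′∈ , eq)
    to (_ , here refl , refl) with ∈-map⁻ f (∈-nub⁻ (map f qs) (member⁻ isEq (f q) _ p))
    ... | q′ , q′∈ , fq≡ = Equivalence.to (L⇔ _) (q′ , q′∈ , sym (proj₁ (agree (here refl) (there q′∈)) fq≡))
  ... | L , len≡ , uniq , L⇔ | false = g q ∷ L , cong suc len≡ , All.tabulate new ∷ uniq , λ x → mk⇔ to from
    where
    new : ∀ {x} → x ∈ L → g q ≢ x
    new x∈ refl with Equivalence.from (L⇔ _) x∈
    ... | q′ , q′∈ , gq′≡ = false≢true (trans (sym p) (member⁺ isEq
      (subst (_∈ nub eq (map f qs)) (sym (proj₂ (agree (here refl) (there q′∈)) (sym gq′≡))) (∈-nub⁺ (∈-map⁺ f q′∈)))))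
    to : ∀ {x} → (∃ λ q′ → q′ ∈ q ∷ qs × g q′ ≡ x) → x ∈ g q ∷ L
    to (_ , here refl , refl)  = here refl
    to (q′ , there q′∈ , eq) = there (Equivalence.to (L⇔ _) (q′ , q′∈ , eq))
    from : ∀ {x} → x ∈ g q ∷ L → ∃ λ q′ → q′ ∈ q ∷ qs × g q′ ≡ x
    from (here refl) = q , here refl , refl
    from (there x∈) with Equivalence.from (L⇔ _) x∈
    ... | q′ , q′∈ , eq = q′ , there q′∈ , eq

-- Completeness of the enumeration of states and increasing paths.

≤⇒≤ᵇ-true : ∀ {m n} → m ℕ.≤ n → (m ℕ.≤ᵇ n) ≡ true
≤⇒≤ᵇ-true m≤n = T⇒true (ℕₚ.≤⇒≤ᵇ m≤n)

every⁻ : ∀ {A : Set} (p : A → Bool) {x} xs → every p xs ≡ true → x ∈ xs → p x ≡ true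
every⁻ p (_ ∷ xs) ok (here refl) = proj₁ (∧-true⁻ ok)
every⁻ p (_ ∷ xs) ok (there x∈)  = every⁻ p xs (proj₂ (∧-true⁻ ok)) x∈

some⁻ : ∀ {A : Set} (p : A → Bool) xs → some p xs ≡ true → ∃ λ x → x ∈ xs × p x ≡ true
some⁻ p (x ∷ xs) ok with p x in px
... | true  = x , here refl , px
... | false = Product.map id (Product.map there id) (some⁻ p xs ok)

data CodesFrom {k} : ∀ {h} → ℕ → Labels k h → Set where
  []  : ∀ {b} → CodesFrom b []
  _∷_ : ∀ {h b l} {ls : Labels k h} → b ℕ.≤ code l → CodesFrom (suc (code l)) ls → CodesFrom b (l ∷ ls)

module _ {k} (bs : Vec ℕ k) where

  ∈-allLabels⁺ : ∀ {l} → IsLabel bs l → l ∈ allLabels bs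
  ∈-allLabels⁺ {a , b} (a<b , a~b) = ∈-filterᵇ⁺ (isLabel bs) (∈-cartesianProduct⁺ (∈-allFin a) (∈-allFin b))
    (cong₂ _∧_ (ltFin⁺ a<b) (subst (λ c → (lookup bs a ≡ᵇ c) ≡ true) a~b (eq⁺ ≡ᵇ-isEqual (lookup bs a))))

  ∈-allLabels⁻ : ∀ {l} → l ∈ allLabels bs → IsLabel bs l
  ∈-allLabels⁻ {a , b} l∈ with ∧-true⁻ (proj₂ (∈-filterᵇ⁻ (isLabel bs) (cartesianProduct (allFin k) (allFin k)) l∈))
  ... | a<b , a~b = ltFin⁻ a b a<b , eq⁻ ≡ᵇ-isEqual _ _ a~b

  ∈-increasingPaths⁺ : ∀ {h σ b} {ls : Labels k h} → Ascending bs σ ls → CodesFrom b ls →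
    ls ∈ increasingPaths (allLabels bs) h b σ
  ∈-increasingPaths⁺ [] [] = here refl
  ∈-increasingPaths⁺ {suc h} {σ} {b} (cons {l = l} {ls} isL up asc) (b≤l ∷ from) = ∈-concatMap⁺ _ (lose (∈-allLabels⁺ isL) continue)
    where
    continue : l ∷ ls ∈ (if (b ℕ.≤ᵇ code l) ∧ rises σ l
      then map (l ∷_) (increasingPaths (allLabels bs) h (suc (code l)) (exchange l σ)) else [])
    continue rewrite ≤⇒≤ᵇ-true b≤l | up = ∈-map⁺ (l ∷_) (∈-increasingPaths⁺ asc from)

  ∈-increasingPaths⁻ : ∀ {h σ b} {ls : Labels k h} → ls ∈ increasingPaths (allLabels bs) h b σ → Ascending bs σ ls
  ∈-increasingPaths⁻ {zero} {ls = []} _ = []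
  ∈-increasingPaths⁻ {suc h} {σ} {b} {ls} ls∈ with find (∈-concatMap⁻ (λ l → if (b ℕ.≤ᵇ code l) ∧ rises σ l
    then map (l ∷_) (increasingPaths (allLabels bs) h (suc (code l)) (exchange l σ)) else []) {xs = allLabels bs} ls∈)
  ... | l , l∈ , ls∈′ with b ℕ.≤ᵇ code l | rises σ l in up
  ...   | true | true with ∈-map⁻ (l ∷_) ls∈′
  ...     | ls′ , ls′∈ , refl = cons (∈-allLabels⁻ l∈) up (∈-increasingPaths⁻ ls′∈)

∈-arrangements : ∀ {k h} (As : Vec (List (Fin k)) h) used (σ : Vec (Fin k) h) → (∀ i → lookup σ i ∈ lookup As i) →
  (∀ i j → lookup σ i ≡ lookup σ j → i ≡ j) → (∀ i → lookup σ i ∉ used) → σ ∈ arrangements As used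
∈-arrangements [] used [] _ _ _ = here refl
∈-arrangements (A ∷ As) used (a ∷ σ) σ∈As inj fresh = ∈-concatMap⁺ _ (lose (σ∈As zero) continue)
  where
  continue : a ∷ σ ∈ (if member eqFin a used then [] else map (a ∷_) (arrangements As (a ∷ used)))
  continue with member eqFin a used in p
  ... | true  = ⊥-elim (fresh zero (member⁻ eqFin-isEqual a used p))
  ... | false = ∈-map⁺ (a ∷_) (∈-arrangements As (a ∷ used) σ (σ∈As ∘ suc)
    (λ i j eq → Finₚ.suc-injective (inj (suc i) (suc j) eq))
    (λ i → λ where
      (here σi≡a) → case-suc (inj (suc i) zero σi≡a)
      (there σi∈) → fresh (suc i) σi∈))
    where
    case-suc : ∀ {m} {i : Fin m} → Fin.suc i ≡ zero → ⊥
    case-suc ()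

∈-allStates : ∀ {k} (bs : Vec ℕ k) (σ : State k) → (∀ i → lookup bs (lookup σ i) ≡ lookup bs i) →
  (∀ i j → lookup σ i ≡ lookup σ j → i ≡ j) → σ ∈ allStates bs
∈-allStates {k} bs σ block inj = ∈-arrangements (Vec.tabulate (λ i → filterᵇ (sameBlock bs i) (allFin k))) [] σ
  (λ i → subst (lookup σ i ∈_) (sym (Vecₚ.lookup∘tabulate (λ i → filterᵇ (sameBlock bs i) (allFin k)) i))
    (∈-filterᵇ⁺ (sameBlock bs i) (∈-allFin (lookup σ i)) (subst (λ c → (lookup bs i ≡ᵇ c) ≡ true) (sym (block i)) (eq⁺ ≡ᵇ-isEqual (lookup bs i)))))
  inj (λ _ ())

checkStates⁻ : ∀ {k} ls tree {σ : State k} σs → checkStates ls tree σs ≡ true → σ ∈ σs →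
  descentsFlip ls σ ≡ true × checkPaths 100 tree σ (increasingPaths ls 4 0 σ) ≡ true
checkStates⁻ ls tree (σ ∷ σs) checked (here refl) = Product.map id (proj₁ ∘ ∧-true⁻) (∧-true⁻ checked)
checkStates⁻ ls tree (τ ∷ σs) checked (there σ∈) = checkStates⁻ ls tree σs (proj₂ (∧-true⁻ (proj₂ (∧-true⁻ {descentsFlip ls τ} checked)))) σ∈

-- q may have been struck off with the class C of an earlier q₀, hence C is described by q₀.
-- Membership of q is conditional on that of q₀, which only `closure` supplies.
checkPaths⁻ : ∀ {k} f tree {σ : State k} {q} qs (P : Labels k 4 → Set) → All P qs → checkPaths f tree σ qs ≡ true → q ∈ qs →
  ∃ λ C → ∃ λ q₀ → P q₀ × Search.search eqLabels (flips σ) 100 (q₀ ∷ [] , q₀ ∷ []) ≡ (C , []) ×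
    (q₀ ∈ C → q ∈ C) × checkClass tree σ C ≡ true
checkPaths⁻ (suc f) tree {σ} {q} (q₀ ∷ qs) P (pq₀ ∷ pqs) checked q∈
  with Search.search eqLabels (flips σ) 100 (q₀ ∷ [] , q₀ ∷ []) in result
... | C , [] with member eqLabels q C in p | q∈
...   | true  | _ = C , q₀ , pq₀ , result , (λ _ → member⁻ (eqVec-isEqual eqLabel-isEqual) q C p) , proj₁ (∧-true⁻ checked)
...   | false | here refl = C , q₀ , pq₀ , result , id , proj₁ (∧-true⁻ checked)
...   | false | there q∈qs = checkPaths⁻ f tree (filterᵇ (λ q → not (member eqLabels q C)) qs) P
          (Allₚ.filter⁺ _ pqs) (proj₂ (∧-true⁻ checked)) (∈-filterᵇ⁺ _ q∈qs (cong not p))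

-- Following a reflection ordering down the tree.

-- A relation, since sortedness for a given ordering comes with no decision procedure; the descent
-- through the tree settles it for each sequence.
data Count {A : Set} (P : A → Set) : List A → ℕ → Set where
  []    : Count P [] 0
  hit   : ∀ {x xs m} → P x → Count P xs m → Count P (x ∷ xs) (suc m)
  miss  : ∀ {x xs m} → ¬ P x → Count P xs m → Count P (x ∷ xs) m

∈-delete⁺ : ∀ s {x} xs → x ∈ xs → s ≢ x → x ∈ delete s xs
∈-delete⁺ s {x} xs x∈ s≢x = ∈-filterᵇ⁺ (λ x → not (s ≡ᵇ x)) x∈ (cong not (eq-false ≡ᵇ-isEqual s x s≢x))

∈-delete⁻ : ∀ s {x} xs → x ∈ delete s xs → x ∈ xs
∈-delete⁻ s xs x∈ = proj₁ (∈-filterᵇ⁻ (λ x → not (s ≡ᵇ x)) xs x∈)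

module OrderTreeProperties (ls : List ℕ) (_≤ₗ_ : ℕ → ℕ → Set)
  (total : ∀ {x y} → x ∈ ls → y ∈ ls → x ≤ₗ y ⊎ y ≤ₗ x)
  (antisym : ∀ {x y} → x ≤ₗ y → y ≤ₗ x → x ≡ y) (transitive : ∀ {x y z} → x ≤ₗ y → y ≤ₗ z → x ≤ₗ z)
  (trs : List Triple)
  (between : ∀ {x y z} → (x , y , z) ∈ trs → x ∈ ls × y ∈ ls × z ∈ ls × x ≢ y × y ≢ z ×
    ((x ≤ₗ y × y ≤ₗ z) ⊎ (z ≤ₗ y × y ≤ₗ x))) where

  _<ₗ_ : ℕ → ℕ → Set
  x <ₗ y = x ≤ₗ y × x ≢ y

  Sorted : List ℕ → Set
  Sorted = AllPairs _<ₗ_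

  least : ∀ r rem → r ∷ rem ⊆ ls → ∃ λ s → s ∈ r ∷ rem × (∀ {y} → y ∈ r ∷ rem → s ≤ₗ y)
  least r [] rem⊆ = r , here refl , λ where (here refl) → Sum.[ id , id ]′ (total (rem⊆ (here refl)) (rem⊆ (here refl)))
  least r (x ∷ rem) rem⊆ with least x rem (rem⊆ ∘ there)
  ... | s , s∈ , s≤ with total (rem⊆ (here refl)) (rem⊆ (there s∈))
  ...   | inj₁ r≤s = r , here refl , λ where
            (here refl) → Sum.[ id , id ]′ (total (rem⊆ (here refl)) (rem⊆ (here refl)))
            (there y∈)  → transitive r≤s (s≤ y∈)
  ...   | inj₂ s≤r = s , there s∈ , λ where (here refl) → s≤r ; (there y∈) → s≤ y∈

  ReverseClosed : List ℕ → Set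
  ReverseClosed rem = ∀ {x y} → x ∈ ls → x ∉ rem → y ∈ rem → x ≤ₗ y

  memberℕ⁻ : ∀ x rem → memberℕ x rem ≡ true → x ∈ rem
  memberℕ⁻ = member⁻ ≡ᵇ-isEqual

  memberℕ-false : ∀ x rem → memberℕ x rem ≡ false → x ∉ rem
  memberℕ-false x rem p x∈ = false≢true (trans (sym p) (member⁺ ≡ᵇ-isEqual x∈))

  -- Each case that `canBeLeast` rejects would put y below both x and z or above both, against
  -- `between`; labels outside `rem` lie below those in it.
  least-canBeLeast : ∀ {s rem} → ReverseClosed rem → s ∈ rem → (∀ {y} → y ∈ rem → s ≤ₗ y) →
    ∀ ts → ts ⊆ trs → canBeLeast ts s rem ≡ true
  least-canBeLeast closed s∈ s≤ [] _ = refl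
  least-canBeLeast {s} {rem} closed s∈ s≤ ((x , y , z) ∷ ts) ts⊆
    with between (ts⊆ (here refl)) | least-canBeLeast {s} {rem} closed s∈ s≤ ts (ts⊆ ∘ there)
  ... | x∈ , y∈ , z∈ , x≢y , y≢z , order | rest = cong₂ _∧_ (first-triple order) rest
    where
    first-triple : (x ≤ₗ y × y ≤ₗ z) ⊎ (z ≤ₗ y × y ≤ₗ x) → (if s ≡ᵇ y then not (memberℕ x rem ∧ memberℕ z rem) else
      if s ≡ᵇ x then not (memberℕ y rem) ∨ memberℕ z rem else
      if s ≡ᵇ z then not (memberℕ y rem) ∨ memberℕ x rem else true) ≡ true
    first-triple o with s ≡ᵇ y in p | s ≡ᵇ x in q | s ≡ᵇ z in r | memberℕ x rem in mx | memberℕ y rem in my | memberℕ z rem in mz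
    ... | true  | _ | _ | false | _ | _ = refl
    ... | true  | _ | _ | true | _ | false = refl
    ... | true  | _ | _ | true | _ | true with eq⁻ ≡ᵇ-isEqual s y p | o
    ...   | refl | inj₁ (x≤y , _) = ⊥-elim (x≢y (antisym x≤y (s≤ (memberℕ⁻ x rem mx))))
    ...   | refl | inj₂ (z≤y , _) = ⊥-elim (y≢z (antisym (s≤ (memberℕ⁻ z rem mz)) z≤y))
    first-triple o | false | true | _ | _ | false | _ = refl
    first-triple o | false | true | _ | _ | true | true = refl
    first-triple o | false | true | _ | _ | true | false with eq⁻ ≡ᵇ-isEqual s x q | o
    ...   | refl | inj₁ (_ , y≤z) = ⊥-elim (y≢z (antisym y≤z (closed z∈ (memberℕ-false z rem mz) (memberℕ⁻ y rem my))))
    ...   | refl | inj₂ (_ , y≤x) = ⊥-elim (x≢y (antisym (s≤ (memberℕ⁻ y rem my)) y≤x))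
    first-triple o | false | false | false | _ | _ | _ = refl
    first-triple o | false | false | true | _ | false | _ = refl
    first-triple o | false | false | true | true | true | _ = refl
    first-triple o | false | false | true | false | true | _ with eq⁻ ≡ᵇ-isEqual s z r | o
    ...   | refl | inj₁ (_ , y≤z) = ⊥-elim (y≢z (antisym y≤z (s≤ (memberℕ⁻ y rem my))))
    ...   | refl | inj₂ (_ , y≤x) = ⊥-elim (x≢y (antisym (closed x∈ (memberℕ-false x rem mx) (memberℕ⁻ y rem my)) y≤x))

  ∈-branches : ∀ {f rem s} ss → s ∈ ss → canBeLeast trs s rem ≡ true →
    (s , orderTree trs f (delete s rem)) ∈ branches trs f rem ss
  ∈-branches (s ∷ ss) (here refl) ok rewrite ok = here refl
  ∈-branches {f} {rem} (x ∷ ss) (there s∈) ok with canBeLeast trs x rem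
  ... | true  = there (∈-branches ss s∈ ok)
  ... | false = ∈-branches ss s∈ ok

  allCountTo⁻ : ∀ {c s t a qs} ts → (s , t) ∈ ts → allCountTo c ts a qs ≡ true → countsTo c t (removeLeast s qs a) ≡ true
  allCountTo⁻ (_ ∷ ts) (here refl) checked = proj₁ (∧-true⁻ checked)
  allCountTo⁻ (_ ∷ ts) (there st∈) checked = allCountTo⁻ ts st∈ (proj₂ (∧-true⁻ checked))

  countsTo-node : ∀ {c s t a q qs} ts → (s , t) ∈ ts → countsTo c (node ts) (tally a (q ∷ qs)) ≡ true →
    countsTo c t (removeLeast s (q ∷ qs) a) ≡ true
  countsTo-node (t ∷ ts) st∈ checked = allCountTo⁻ (t ∷ ts) st∈ checked

  -- Runs from the pending sequences back to qs, because their count becomes known only further down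
  -- the branch.
  CountsAs : ℕ → List (List ℕ) → Tally → Set
  CountsAs a qs t = ∀ {m} → Count Sorted (Tally.pending t) m → ∃ λ m′ → Count Sorted qs m′ × a + m′ ≡ Tally.found t + m

  countsAs-drop : ∀ {a q qs t} → ¬ Sorted q → CountsAs a qs t → CountsAs a (q ∷ qs) t
  countsAs-drop ¬sorted counts count with counts count
  ... | m , count′ , eq = m , miss ¬sorted count′ , eq

  countsAs-found : ∀ {a q qs t} → Sorted q → CountsAs a qs t → CountsAs a (q ∷ qs) (addFound t)
  countsAs-found {a} sorted counts count with counts count
  ... | m , count′ , eq = suc m , hit sorted count′ , trans (ℕₚ.+-suc a m) (cong suc eq)

  countsAs-open : ∀ {a q q′ qs t} → (Sorted q′ → Sorted q) → (Sorted q → Sorted q′) →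
    CountsAs a qs t → CountsAs a (q ∷ qs) (addOpen q′ t)
  countsAs-open {a} {t = t} to from counts (hit {m = m} sorted count) with counts count
  ... | m′ , count′ , eq = suc m′ , hit (to sorted) count′ , trans (ℕₚ.+-suc a m′) (trans (cong suc eq) (sym (ℕₚ.+-suc (Tally.found t) m)))
  countsAs-open to from counts (miss ¬sorted count) with counts count
  ... | m′ , count′ , eq = m′ , miss (¬sorted ∘ from) count′ , eq

  module _ {s : ℕ} {rem : List ℕ} (s≤ : ∀ {y} → y ∈ rem → s ≤ₗ y) where

    delete⁺ : ∀ {q} → All (_∈ rem) q → s ∉ q → All (_∈ delete s rem) q
    delete⁺ q∈ s∉ = All.tabulate (λ {y} y∈ → ∈-delete⁺ s rem (All.lookup q∈ y∈) (λ where refl → s∉ y∈))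

    late : ∀ {x q} → x ∈ rem → s ∈ q → ¬ Sorted (x ∷ q)
    late x∈ s∈ (x<q ∷ _) with All.lookup x<q s∈
    ... | x≤s , x≢s = x≢s (antisym x≤s (s≤ x∈))

    prepend : ∀ {q} → All (_∈ rem) q → s ∉ q → Sorted q → Sorted (s ∷ q)
    prepend q∈ s∉ sorted = All.tabulate (λ y∈ → s≤ (All.lookup q∈ y∈) , λ where refl → s∉ y∈) ∷ sorted

    uncons : ∀ {x q} → Sorted (x ∷ q) → Sorted q
    uncons (_ ∷ sorted) = sorted

    removeLeast-correct : ∀ a qs → All (All (_∈ rem)) qs →
      CountsAs a qs (removeLeast s qs a) × All (All (_∈ delete s rem)) (Tally.pending (removeLeast s qs a))
    removeLeast-correct a [] [] = (λ count → _ , count , refl) , []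
    removeLeast-correct a ([] ∷ qs) ([] ∷ qs∈) with removeLeast-correct a qs qs∈
    ... | counts , open∈ = countsAs-found [] counts , open∈
    removeLeast-correct a ((x ∷ q) ∷ qs) ((x∈ ∷ q∈) ∷ qs∈) with removeLeast-correct a qs qs∈ | memberℕ s q in p | s ≡ᵇ x in sx
    ... | counts , open∈ | true | _ = countsAs-drop (late x∈ (memberℕ⁻ s q p)) counts , open∈
    ... | counts , open∈ | false | false = countsAs-open id id counts ,
        delete⁺ (x∈ ∷ q∈) (λ where
          (here refl) → false≢true (trans (sym sx) (eq⁺ ≡ᵇ-isEqual s))
          (there s∈) → memberℕ-false s q p s∈) ∷ open∈
    ... | counts , open∈ | false | true with eq⁻ ≡ᵇ-isEqual s x sx | q
    ...   | refl | [] = countsAs-found ([] ∷ []) counts , open∈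
    ...   | refl | y ∷ [] = countsAs-found (prepend q∈ (memberℕ-false s _ p) ([] ∷ [])) counts , open∈
    ...   | refl | y ∷ z ∷ q′ = countsAs-open (prepend q∈ (memberℕ-false s _ p)) uncons counts ,
              delete⁺ q∈ (memberℕ-false s _ p) ∷ open∈

  -- Follows the single branch that takes the least remaining label each time. It exists by
  -- `least-canBeLeast`, and `allCountTo` holds on every branch.
  countsTo-correct : ∀ c f rem a qs → rem ⊆ ls → ReverseClosed rem → All (All (_∈ rem)) qs →
    countsTo c (orderTree trs f rem) (tally a qs) ≡ true → ∃ λ m → Count Sorted qs m × a + m ≡ c
  countsTo-correct c f rem a [] _ _ _ checked = 0 , [] , trans (ℕₚ.+-identityʳ a) (eq⁻ ≡ᵇ-isEqual a c (base (orderTree trs f rem) checked))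
    where
    base : ∀ t → countsTo c t (tally a []) ≡ true → (a ≡ᵇ c) ≡ true
    base (node []) p      = p
    base (node (_ ∷ _)) p = p
  countsTo-correct c (suc f) (r ∷ rem) a (q ∷ qs) rem⊆ closed qs∈ checked with least r rem rem⊆
  ... | s , s∈ , s≤ with removeLeast-correct s≤ a (q ∷ qs) qs∈
    | countsTo-node {a = a} {q} {qs} (branches trs f (r ∷ rem) (r ∷ rem))
        (∈-branches (r ∷ rem) s∈ (least-canBeLeast closed s∈ s≤ trs id)) checked
  ...   | counts , open∈ | checked′ with countsTo-correct c f (delete s (r ∷ rem)) (Tally.found next) (Tally.pending next)
            (rem⊆ ∘ ∈-delete⁻ s (r ∷ rem)) closed′ open∈ checked′
    where
    next : Tally
    next = removeLeast s (q ∷ qs) a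
    closed′ : ReverseClosed (delete s (r ∷ rem))
    closed′ {x} x∈ x∉ y∈ with x ℕ.≟ s
    ... | yes refl = s≤ (∈-delete⁻ x (r ∷ rem) y∈)
    ... | no x≢s = closed x∈ (λ x∈rem → x∉ (∈-delete⁺ s (r ∷ rem) x∈rem (x≢s ∘ sym)))
        (∈-delete⁻ s (r ∷ rem) y∈)
  ...     | m , count , eq with counts count
  ...       | m′ , count′ , eq′ = m′ , count′ , trans eq′ eq

-- Partitioning the values into blocks joined by labels.

allPairs-↭ : ∀ {A : Set} {R : A → A → Set} → (∀ {x y} → R x y → R y x) → ∀ {xs ys} → xs ↭ ys → AllPairs R xs → AllPairs R ys
allPairs-↭ sym Perm.refl ps = ps
allPairs-↭ sym (Perm.prep x p) (q ∷ ps) = Permₚ.All-resp-↭ p q ∷ allPairs-↭ sym p ps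
allPairs-↭ sym (Perm.swap x y p) ((xy ∷ q) ∷ q′ ∷ ps) =
  (sym xy ∷ Permₚ.All-resp-↭ p q′) ∷ Permₚ.All-resp-↭ p q ∷ allPairs-↭ sym p ps
allPairs-↭ sym (Perm.trans p p′) ps = allPairs-↭ sym p′ (allPairs-↭ sym p ps)

∈⇒↭∷ : ∀ {A : Set} {x : A} {xs} → x ∈ xs → ∃ λ ys → xs ↭ x ∷ ys
∈⇒↭∷ x∈ with ∈-∃++ x∈
... | as , bs , refl = as ++ bs , Permₚ.shift _ as bs

-- For nonempty blocks, the rank of the product of the symmetric groups on them.
excess : ∀ {A : Set} → List (List A) → ℕ
excess Bs = sum (map (pred ∘ length) Bs)

Joined : ∀ {n} → List (List (Fin n)) → Fin n → Fin n → Set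
Joined Bs a b = ∃ λ B → B ∈ Bs × a ∈ B × b ∈ B

record Partition (n m : ℕ) : Set where
  field
    blocks   : List (List (Fin n))
    disjoint : AllPairs Disjoint blocks
    uniques  : All Unique blocks
    bounded  : excess blocks ℕ.≤ m
    covering : ∀ v → ∃ λ B → B ∈ blocks × v ∈ B

disjoint-sym : ∀ {A : Set} {xs ys : List A} → Disjoint xs ys → Disjoint ys xs
disjoint-sym d (y∈ , x∈) = d (x∈ , y∈)

disjoint-++ : ∀ {A : Set} (xs ys zs : List A) → Disjoint xs zs → Disjoint ys zs → Disjoint (xs ++ ys) zs
disjoint-++ xs ys zs d d′ (v∈ , v∈zs) = Sum.[ (λ v∈xs → d (v∈xs , v∈zs)) , (λ v∈ys → d′ (v∈ys , v∈zs)) ]′ (∈-++⁻ xs v∈)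

singletons : ∀ n → Partition n 0
singletons n = record
  { blocks = map List.[_] (allFin n)
  ; disjoint = AllPairsₚ.map⁺ (AllPairs.map (λ where x≢y (here refl , here refl) → x≢y refl) (Uniqueₚ.allFin⁺ n))
  ; uniques = Allₚ.map⁺ (All.universal (λ _ → [] ∷ []) (allFin n))
  ; bounded = ℕₚ.≤-reflexive (no-excess (allFin n))
  ; covering = λ v → List.[ v ] , ∈-map⁺ List.[_] (∈-allFin v) , here refl }
  where
  no-excess : ∀ {A : Set} (xs : List A) → excess (map List.[_] xs) ≡ 0
  no-excess []       = refl
  no-excess (x ∷ xs) = no-excess xs

-- Two blocks of sizes x and y have merged excess one larger than the sum of theirs. It is only an
-- inequality because empty lists are not excluded from `blocks`.
pred-+ : ∀ x y → pred (x + y) ℕ.≤ suc (pred x + pred y)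
pred-+ zero    zero    = z≤n
pred-+ zero    (suc y) = ℕₚ.n≤1+n y
pred-+ (suc x) zero    = ℕₚ.n≤1+n (x + 0)
pred-+ (suc x) (suc y) = ℕₚ.≤-reflexive (ℕₚ.+-suc x y)

merge : ∀ {n m} (P : Partition n m) a b → Σ (Partition n (suc m)) λ Q →
  Joined (Partition.blocks Q) a b × (∀ {c d} → Joined (Partition.blocks P) c d → Joined (Partition.blocks Q) c d)
merge {n} {m} P a b with Partition.covering P a | Partition.covering P b
... | B , B∈ , a∈B | B′ , B′∈ , b∈B′ with DecMembership._∈?_ Finₚ._≟_ b B
...   | yes b∈B = record { blocks = blocks ; disjoint = disjoint ; uniques = uniques ; bounded = ℕₚ.m≤n⇒m≤1+n bounded ; covering = covering } ,
          (B , B∈ , a∈B , b∈B) , id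
          where open Partition P
...   | no b∉B with ∈⇒↭∷ B∈
...     | rest , p with Permₚ.∈-resp-↭ p B′∈
...       | here refl = ⊥-elim (b∉B b∈B′)
...       | there B′∈rest with ∈⇒↭∷ B′∈rest
...         | rest′ , p′ = record
                { blocks = (B ++ B′) ∷ rest′
                ; disjoint = joinDisjoint (allPairs-↭ disjoint-sym p″ disjoint)
                ; uniques = joinUnique (Permₚ.All-resp-↭ p″ uniques) (allPairs-↭ disjoint-sym p″ disjoint)
                ; bounded = bounded′
                -- `joined` for the pair v, v: the block of v survives, possibly enlarged.
                ; covering = λ v → Product.map id (λ (X∈ , v∈ , _) → X∈ , v∈) (joined (let (X , X∈ , v∈) = covering v in X , X∈ , v∈ , v∈)) } ,
              (B ++ B′ , here refl , ∈-++⁺ˡ a∈B , ∈-++⁺ʳ B b∈B′) , joined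
  where
  open Partition P
  p″ : blocks ↭ B ∷ B′ ∷ rest′
  p″ = Perm.trans p (Perm.prep B p′)
  joinDisjoint : AllPairs Disjoint (B ∷ B′ ∷ rest′) → AllPairs Disjoint ((B ++ B′) ∷ rest′)
  joinDisjoint ((_ ∷ dB) ∷ dB′ ∷ d) = All.tabulate (λ {X} X∈ → disjoint-++ B B′ X (All.lookup dB X∈) (All.lookup dB′ X∈)) ∷ d
  joinUnique : All Unique (B ∷ B′ ∷ rest′) → AllPairs Disjoint (B ∷ B′ ∷ rest′) → All Unique ((B ++ B′) ∷ rest′)
  joinUnique (uB ∷ uB′ ∷ us) ((d ∷ _) ∷ _) = Uniqueₚ.++⁺ uB uB′ d ∷ us
  bounded′ : excess ((B ++ B′) ∷ rest′) ℕ.≤ suc m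
  bounded′ = begin
    pred (length (B ++ B′)) + excess rest′               ≡⟨ cong (λ k → pred k + excess rest′) (Listₚ.length-++ B) ⟩
    pred (length B + length B′) + excess rest′           ≤⟨ ℕₚ.+-monoˡ-≤ (excess rest′) (pred-+ (length B) (length B′)) ⟩
    suc (pred (length B) + pred (length B′) + excess rest′) ≡⟨ cong suc (ℕₚ.+-assoc (pred (length B)) _ _) ⟩
    suc (excess (B ∷ B′ ∷ rest′))                        ≡⟨ cong suc (Sumₚ.sum-↭ (Permₚ.map⁺ (pred ∘ length) p″)) ⟨
    suc (excess blocks)                                  ≤⟨ s≤s bounded ⟩
    suc m                                                ∎
    where open ℕₚ.≤-Reasoning
  joined : ∀ {c d} → Joined blocks c d → Joined ((B ++ B′) ∷ rest′) c d
  joined (X , X∈ , c∈ , d∈) with Permₚ.∈-resp-↭ p″ X∈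
  ... | here refl         = B ++ B′ , here refl , ∈-++⁺ˡ c∈ , ∈-++⁺ˡ d∈
  ... | there (here refl) = B ++ B′ , here refl , ∈-++⁺ʳ B c∈ , ∈-++⁺ʳ B d∈
  ... | there (there X∈′) = X , there X∈′ , c∈ , d∈

-- One merge per label, starting from singletons, so the excess is at most the number of labels.
partition : ∀ {n m} (ts : Vec (Transp n) m) → Σ (Partition n m) λ P →
  VecAll.All (λ t → Joined (Partition.blocks P) (Transp.a t) (Transp.b t)) ts
partition {n} [] = singletons n , VecAll.[]
partition (t ∷ ts) with partition ts
... | P , joined with merge P (Transp.a t) (Transp.b t)
...   | Q , new , old = Q , new VecAll.∷ VecAll.map old joined

-- From blocks of values to a copy of a model.

∈-blockSizes : ∀ m ss → All (2 ℕ.≤_) ss → sum (map pred ss) ℕ.≤ m → ss ∈ blockSizes m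
∈-blockSizes zero    []       _ _ = here refl
∈-blockSizes (suc m) []       _ _ = here refl
∈-blockSizes (suc m) (suc (suc zero) ∷ ss) (_ ∷ big) (s≤s bound) = there (∈-++⁺ˡ (∈-map⁺ (2 ∷_) (∈-blockSizes m ss big bound)))
∈-blockSizes (suc m) (suc (suc (suc s)) ∷ ss) (_ ∷ big) (s≤s bound) =
  there (∈-++⁺ʳ (map (2 ∷_) (blockSizes m)) (∈-map⁺ incrementHead (∈-blockSizes m (suc (suc s) ∷ ss) (s≤s (s≤s z≤n) ∷ big) bound)))
∈-blockSizes zero    (suc zero ∷ ss) (s≤s () ∷ _) _
∈-blockSizes (suc m) (suc zero ∷ ss) (s≤s () ∷ _) _

-- Singletons are dropped: no label moves their values, and without them only finitely many lists of
-- sizes remain.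
isBig? : ∀ {A : Set} (B : List A) → Dec (2 ℕ.≤ length B)
isBig? B = 2 ℕ.≤? length B

excess-filter : ∀ {A : Set} (Bs : List (List A)) → excess (filter isBig? Bs) ℕ.≤ excess Bs
excess-filter [] = z≤n
excess-filter (B ∷ Bs) with does (isBig? B)
... | true  = ℕₚ.+-monoʳ-≤ (pred (length B)) (excess-filter Bs)
... | false = ℕₚ.m≤n⇒m≤o+n (pred (length B)) (excess-filter Bs)

joined-isBig : ∀ {n} {a b : Fin n} {B} → a ≢ b → a ∈ B → b ∈ B → 2 ℕ.≤ length B
joined-isBig a≢b a∈ b∈ = unique-⊆⇒length≤ ((a≢b ∷ []) ∷ [] ∷ []) λ where
  (here refl)         → a∈
  (there (here refl)) → b∈

data Side (m n : ℕ) : Fin (m + n) → Set where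
  left  : ∀ i → Side m n (i Fin.↑ˡ n)
  right : ∀ j → Side m n (m Fin.↑ʳ j)

side : ∀ m {n} i → Side m n i
side zero    i       = right i
side (suc m) zero    = left zero
side (suc m) (suc i) with side m i
... | left j  = left (suc j)
... | right j = right j

_⊕_ : ∀ {A : Set} {m n} → (Fin m → A) → (Fin n → A) → Fin (m + n) → A
_⊕_ {m = m} f g i = Sum.[ f , g ]′ (Fin.splitAt m i)

⊕-left : ∀ {A : Set} {m n} (f : Fin m → A) (g : Fin n → A) i → (f ⊕ g) (i Fin.↑ˡ n) ≡ f i
⊕-left {m = m} {n} f g i = cong Sum.[ f , g ]′ (Finₚ.splitAt-↑ˡ m i n)

⊕-right : ∀ {A : Set} {m n} (f : Fin m → A) (g : Fin n → A) j → (f ⊕ g) (m Fin.↑ʳ j) ≡ g j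
⊕-right {m = m} {n} f g j = cong Sum.[ f , g ]′ (Finₚ.splitAt-↑ʳ m n j)

⊕-injective : ∀ {A : Set} {m n} {f : Fin m → A} {g : Fin n → A} → (∀ {i j} → f i ≡ f j → i ≡ j) → (∀ {i j} → g i ≡ g j → i ≡ j) →
  (∀ i j → f i ≢ g j) → ∀ {i j} → (f ⊕ g) i ≡ (f ⊕ g) j → i ≡ j
⊕-injective {m = m} {n} {f} {g} f-inj g-inj apart {i} {j} eq with side m {n} i | side m {n} j
... | left x  | left y  = cong (Fin._↑ˡ n) (f-inj (trans (sym (⊕-left f g x)) (trans eq (⊕-left f g y))))
... | left x  | right y = ⊥-elim (apart x y (trans (sym (⊕-left f g x)) (trans eq (⊕-right f g y))))
... | right x | left y  = ⊥-elim (apart y x (trans (sym (⊕-left f g y)) (trans (sym eq) (⊕-right f g x))))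
... | right x | right y = cong (m Fin.↑ʳ_) (g-inj (trans (sym (⊕-right f g x)) (trans eq (⊕-right f g y))))

blockIds-bound : ∀ ss i → lookup (blockIds ss) i ℕ.< length ss
blockIds-bound (s ∷ ss) i with side s i
... | left j  = subst (ℕ._< suc (length ss)) (sym (trans (Vecₚ.lookup-++ˡ (Vec.replicate s _) (blockIds ss) j) (Vecₚ.lookup-replicate j _))) ℕₚ.≤-refl
... | right j = subst (ℕ._< suc (length ss)) (sym (Vecₚ.lookup-++ʳ (Vec.replicate s (length ss)) (blockIds ss) j)) (ℕₚ.m≤n⇒m≤1+n (blockIds-bound ss j))

blockIds-left : ∀ s ss j → lookup (blockIds (s ∷ ss)) (j Fin.↑ˡ sum ss) ≡ length ss
blockIds-left s ss j = trans (Vecₚ.lookup-++ˡ (Vec.replicate s (length ss)) (blockIds ss) j) (Vecₚ.lookup-replicate j _)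

blockIds-right : ∀ s ss j → lookup (blockIds (s ∷ ss)) (s Fin.↑ʳ j) ≡ lookup (blockIds ss) j
blockIds-right s ss j = Vecₚ.lookup-++ʳ (Vec.replicate s (length ss)) (blockIds ss) j

Monotone : ∀ {m n} → (Fin m → Fin n) → Set
Monotone f = ∀ {i j} → i Fin.< j → f i Fin.< f j

MonotoneOnBlocks : ∀ {n} ss → (Fin (sum ss) → Fin n) → Set
MonotoneOnBlocks ss f = ∀ {i j} → i Fin.< j → lookup (blockIds ss) i ≡ lookup (blockIds ss) j → f i Fin.< f j

⊕-monotone : ∀ {n} s ss {f : Fin s → Fin n} {g : Fin (sum ss) → Fin n} → Monotone f → MonotoneOnBlocks ss g → MonotoneOnBlocks (s ∷ ss) (f ⊕ g)
⊕-monotone s ss {f} {g} f-mono g-mono {i} {j} i<j same with side s i | side s j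
... | left x | left y = subst₂ Fin._<_ (sym (⊕-left f g x)) (sym (⊕-left f g y))
        (f-mono (subst₂ ℕ._<_ (Finₚ.toℕ-↑ˡ x (sum ss)) (Finₚ.toℕ-↑ˡ y (sum ss)) i<j))
... | left x | right y = ⊥-elim (ℕₚ.<-irrefl (trans (sym (blockIds-right s ss y)) (trans (sym same) (blockIds-left s ss x))) (blockIds-bound ss y))
... | right x | left y = ⊥-elim (ℕₚ.<-irrefl (trans (sym (blockIds-right s ss x)) (trans same (blockIds-left s ss y))) (blockIds-bound ss x))
... | right x | right y = subst₂ Fin._<_ (sym (⊕-right f g x)) (sym (⊕-right f g y))
        (g-mono (ℕₚ.+-cancelˡ-< s _ _ (subst₂ ℕ._<_ (Finₚ.toℕ-↑ʳ s x) (Finₚ.toℕ-↑ʳ s y) i<j))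
          (trans (sym (blockIds-right s ss x)) (trans same (blockIds-right s ss y))))

record Enumeration {n} (xs : List (Fin n)) (s : ℕ) : Set where
  field
    at       : Fin s → Fin n
    monotone : Monotone at
    at-∈     : ∀ i → at i ∈ xs
    onto     : ∀ {v} → v ∈ xs → ∃ λ i → at i ≡ v

  injective : ∀ {i j} → at i ≡ at j → i ≡ j
  injective {i} {j} eq with Finₚ.<-cmp i j
  ... | tri< i<j _ _ = ⊥-elim (Finₚ.<-irrefl eq (monotone i<j))
  ... | tri≈ _ i≡j _ = i≡j
  ... | tri> _ _ j<i = ⊥-elim (Finₚ.<-irrefl (sym eq) (monotone j<i))

enumerate : ∀ {n} (xs : List (Fin n)) {s} → AllPairs Fin._<_ xs → length xs ≡ s → Enumeration xs s
enumerate xs sorted refl = record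
  { at = List.lookup xs ; monotone = increasing sorted ; at-∈ = ∈-lookup {xs = xs}
  ; onto = λ v∈ → Any.index v∈ , sym (Anyₚ.lookup-index v∈) }
  where
  increasing : ∀ {n} {xs : List (Fin n)} → AllPairs Fin._<_ xs → Monotone (List.lookup xs)
  increasing (x< ∷ _) {zero} {suc j} _ = All.lookup x< (∈-lookup j)
  increasing (_ ∷ sorted) {suc i} {suc j} (s≤s i<j) = increasing sorted i<j

module _ {n} (u : Word n) (perm : IsPerm u) (B : List (Fin n)) (B-unique : Unique B) where

  private
    _∈?_ = DecMembership._∈?_ (Finₚ._≟_ {n})

    allFin-sorted : AllPairs Fin._<_ (allFin n)
    allFin-sorted = AllPairsₚ.tabulate⁺-< id

  blockValues : Enumeration (filter (_∈? B) (allFin n)) (length B)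
  blockValues = enumerate _ (AllPairsₚ.filter⁺ (_∈? B) allFin-sorted) (ℕₚ.≤-antisym
    (unique-⊆⇒length≤ (Uniqueₚ.filter⁺ (_∈? B) (Uniqueₚ.allFin⁺ n)) (λ v∈ → proj₂ (∈-filter⁻ (_∈? B) {xs = allFin n} v∈)))
    (unique-⊆⇒length≤ B-unique (λ {v} v∈ → ∈-filter⁺ (_∈? B) (∈-allFin v) v∈)))

  hasValueInB? : ∀ j → Dec (lookup u j ∈ B)
  hasValueInB? j = lookup u j ∈? B

  -- u maps these positions bijectively onto B, so they too are indexed by `Fin (length B)`.
  blockPositions : Enumeration (filter hasValueInB? (allFin n)) (length B)
  blockPositions = enumerate _ (AllPairsₚ.filter⁺ hasValueInB? allFin-sorted) (trans (sym (Listₚ.length-map (lookup u) positions)) (ℕₚ.≤-antisym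
    (unique-⊆⇒length≤ (Uniqueₚ.map⁺ (λ {i} {j} → perm i j) (Uniqueₚ.filter⁺ hasValueInB? (Uniqueₚ.allFin⁺ n))) values⊆)
    (unique-⊆⇒length≤ B-unique ⊆values)))
    where
    positions = filter hasValueInB? (allFin n)
    values⊆ : map (lookup u) positions ⊆ B
    values⊆ v∈ with ∈-map⁻ (lookup u) v∈
    ... | j , j∈ , refl = proj₂ (∈-filter⁻ hasValueInB? {xs = allFin n} j∈)
    ⊆values : B ⊆ map (lookup u) positions
    ⊆values {v} v∈ with perm-surjective u perm v
    ... | j , refl = ∈-map⁺ (lookup u) (∈-filter⁺ hasValueInB? (∈-allFin j) v∈)

-- σ is the state of u. `e-∈` and `r-∈` serve the induction on the blocks: they keep the values and
-- the positions of different blocks apart.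
record Layout {n} (u : Word n) (Bs : List (List (Fin n))) : Set where
  sizes : List ℕ
  sizes = map length Bs
  field
    e r     : Fin (sum sizes) → Fin n
    σ       : Fin (sum sizes) → Fin (sum sizes)
    e-inj   : ∀ {i j} → e i ≡ e j → i ≡ j
    r-inj   : ∀ {i j} → r i ≡ r j → i ≡ j
    e-mono  : MonotoneOnBlocks sizes e
    r-mono  : MonotoneOnBlocks sizes r
    e-∈     : ∀ i → ∃ λ B → B ∈ Bs × e i ∈ B
    r-∈     : ∀ i → ∃ λ B → B ∈ Bs × lookup u (r i) ∈ B
    σ-on    : ∀ i → lookup u (r (σ i)) ≡ e i
    σ-block : ∀ i → lookup (blockIds sizes) (σ i) ≡ lookup (blockIds sizes) i
    e-onto  : ∀ {a b} → Joined Bs a b → ∃₂ λ i j → e i ≡ a × e j ≡ b × lookup (blockIds sizes) i ≡ lookup (blockIds sizes) j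

layout : ∀ {n} (u : Word n) → IsPerm u → ∀ Bs → AllPairs Disjoint Bs → All Unique Bs → Layout u Bs
layout u perm [] [] [] = record
  { e = λ () ; r = λ () ; σ = λ () ; e-inj = λ {i} → ⊥-elim (Finₚ.¬Fin0 i) ; r-inj = λ {i} → ⊥-elim (Finₚ.¬Fin0 i)
  ; e-mono = λ {i} → ⊥-elim (Finₚ.¬Fin0 i) ; r-mono = λ {i} → ⊥-elim (Finₚ.¬Fin0 i)
  ; e-∈ = λ () ; r-∈ = λ () ; σ-on = λ () ; σ-block = λ () ; e-onto = λ where (_ , () , _) }
layout {n} u perm (B ∷ Bs) (B-disjoint ∷ disjoint) (B-unique ∷ uniques) = record
  { e = V.at ⊕ L.e ; r = P.at ⊕ L.r ; σ = σ
  ; e-inj = ⊕-injective V.injective L.e-inj (λ i j eq → apart (V-∈ i) (L.e-∈ j) eq)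
  ; r-inj = ⊕-injective P.injective L.r-inj (λ i j eq → apart (P-∈ i) (L.r-∈ j) (cong (lookup u) eq))
  ; e-mono = ⊕-monotone s ss V.monotone L.e-mono
  ; r-mono = ⊕-monotone s ss P.monotone L.r-mono
  ; e-∈ = λ i → e-∈ i (side s i)
  ; r-∈ = λ i → r-∈ i (side s i)
  ; σ-on = λ i → σ-on i (side s i)
  ; σ-block = λ i → σ-block i (side s i)
  ; e-onto = e-onto }
  where
  s = length B
  ss = map length Bs
  module V = Enumeration (blockValues u perm B B-unique)
  module P = Enumeration (blockPositions u perm B B-unique)
  module L = Layout (layout u perm Bs disjoint uniques)
  V-∈ : ∀ i → V.at i ∈ B
  V-∈ i = proj₂ (∈-filter⁻ (λ v → DecMembership._∈?_ Finₚ._≟_ v B) {xs = allFin n} (V.at-∈ i))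
  P-∈ : ∀ i → lookup u (P.at i) ∈ B
  P-∈ i = proj₂ (∈-filter⁻ (hasValueInB? u perm B B-unique) {xs = allFin n} (P.at-∈ i))
  apart : ∀ {v w} → v ∈ B → (∃ λ X → X ∈ Bs × w ∈ X) → v ≢ w
  apart v∈ (X , X∈ , w∈) refl = All.lookup B-disjoint X∈ (v∈ , w∈)
  position : ∀ i → ∃ λ i′ → lookup u (P.at i′) ≡ V.at i
  position i with perm-surjective u perm (V.at i)
  ... | j , uj≡ with P.onto (∈-filter⁺ (hasValueInB? u perm B B-unique) (∈-allFin j) (subst (_∈ B) (sym uj≡) (V-∈ i)))
  ...   | i′ , refl = i′ , uj≡
  σ : Fin (s + sum ss) → Fin (s + sum ss)
  σ = (λ i → proj₁ (position i) Fin.↑ˡ sum ss) ⊕ (λ j → s Fin.↑ʳ L.σ j)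
  σ-left : ∀ i → σ (i Fin.↑ˡ sum ss) ≡ proj₁ (position i) Fin.↑ˡ sum ss
  σ-left = ⊕-left (λ i → proj₁ (position i) Fin.↑ˡ sum ss) (λ j → s Fin.↑ʳ L.σ j)
  σ-right : ∀ j → σ (s Fin.↑ʳ j) ≡ s Fin.↑ʳ L.σ j
  σ-right = ⊕-right (λ i → proj₁ (position i) Fin.↑ˡ sum ss) (λ j → s Fin.↑ʳ L.σ j)
  e-∈ : ∀ i → Side s (sum ss) i → ∃ λ X → X ∈ B ∷ Bs × (V.at ⊕ L.e) i ∈ X
  e-∈ _ (left i) = B , here refl , subst (_∈ B) (sym (⊕-left V.at L.e i)) (V-∈ i)
  e-∈ _ (right j) with L.e-∈ j
  ... | X , X∈ , v∈ = X , there X∈ , subst (_∈ X) (sym (⊕-right V.at L.e j)) v∈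
  r-∈ : ∀ i → Side s (sum ss) i → ∃ λ X → X ∈ B ∷ Bs × lookup u ((P.at ⊕ L.r) i) ∈ X
  r-∈ _ (left i) = B , here refl , subst (λ j → lookup u j ∈ B) (sym (⊕-left P.at L.r i)) (P-∈ i)
  r-∈ _ (right j) with L.r-∈ j
  ... | X , X∈ , v∈ = X , there X∈ , subst (λ j → lookup u j ∈ X) (sym (⊕-right P.at L.r j)) v∈
  σ-on : ∀ i → Side s (sum ss) i → lookup u ((P.at ⊕ L.r) (σ i)) ≡ (V.at ⊕ L.e) i
  σ-on _ (left i) = trans (cong (lookup u) (trans (cong (P.at ⊕ L.r) (σ-left i)) (⊕-left P.at L.r (proj₁ (position i)))))
    (trans (proj₂ (position i)) (sym (⊕-left V.at L.e i)))
  σ-on _ (right j) = trans (cong (lookup u) (trans (cong (P.at ⊕ L.r) (σ-right j)) (⊕-right P.at L.r (L.σ j))))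
    (trans (L.σ-on j) (sym (⊕-right V.at L.e j)))
  σ-block : ∀ i → Side s (sum ss) i → lookup (blockIds (s ∷ ss)) (σ i) ≡ lookup (blockIds (s ∷ ss)) i
  σ-block _ (left i) = trans (cong (lookup (blockIds (s ∷ ss))) (σ-left i))
    (trans (blockIds-left s ss (proj₁ (position i))) (sym (blockIds-left s ss i)))
  σ-block _ (right j) = trans (cong (lookup (blockIds (s ∷ ss))) (σ-right j))
    (trans (blockIds-right s ss (L.σ j)) (trans (L.σ-block j) (sym (blockIds-right s ss j))))
  e-onto : ∀ {a b} → Joined (B ∷ Bs) a b → ∃₂ λ i j → (V.at ⊕ L.e) i ≡ a × (V.at ⊕ L.e) j ≡ b ×
    lookup (blockIds (s ∷ ss)) i ≡ lookup (blockIds (s ∷ ss)) j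
  e-onto (X , there X∈ , a∈ , b∈) with L.e-onto (X , X∈ , a∈ , b∈)
  ... | i , j , ei≡a , ej≡b , same = s Fin.↑ʳ i , s Fin.↑ʳ j , trans (⊕-right V.at L.e i) ei≡a , trans (⊕-right V.at L.e j) ej≡b ,
    trans (blockIds-right s ss i) (trans same (sym (blockIds-right s ss j)))
  e-onto {a} {b} (_ , here refl , a∈ , b∈)
    with V.onto (∈-filter⁺ (λ v → DecMembership._∈?_ Finₚ._≟_ v B) (∈-allFin a) a∈) | V.onto (∈-filter⁺ (λ v → DecMembership._∈?_ Finₚ._≟_ v B) (∈-allFin b) b∈)
  ... | i , ei≡a | j , ej≡b = i Fin.↑ˡ sum ss , j Fin.↑ˡ sum ss , trans (⊕-left V.at L.e i) ei≡a , trans (⊕-left V.at L.e j) ej≡b ,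
    trans (blockIds-left s ss i) (sym (blockIds-left s ss j))

layout-embedding : ∀ {n} {u : Word n} {Bs} (L : Layout u Bs) → Embedding u (blockIds (Layout.sizes L))
layout-embedding L = record
  { e = e ; r = r ; e-injective = e-inj ; r-injective = r-inj ; e-mono = e-mono ; r-mono = r-mono }
  where open Layout L

layout-tracks : ∀ {n} {u : Word n} → IsPerm u → ∀ {Bs} (L : Layout u Bs) →
  Embedding.Tracks (layout-embedding L) u (Vec.tabulate (Layout.σ L))
layout-tracks {u = u} perm L = record
  { perm = perm
  ; on = λ i → trans (cong (lookup u ∘ r) (Vecₚ.lookup∘tabulate σ i)) (σ-on i)
  ; off = λ _ _ → refl
  ; block = λ i → trans (cong (lookup (blockIds sizes)) (Vecₚ.lookup∘tabulate σ i)) (σ-block i) }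
  where open Layout L

-- Transfer of cardinalities, and codes of labels.

checkAll⁻ : ∀ sss {ss} → checkAll sss ≡ true → ss ∈ sss → checkBlocks (blockIds ss) ≡ true
checkAll⁻ (_ ∷ sss) ok (here refl) = proj₁ (∧-true⁻ ok)
checkAll⁻ (_ ∷ sss) ok (there ss∈) = checkAll⁻ sss (proj₂ (∧-true⁻ ok)) ss∈

HasSize-resp : ∀ {A : Set} {P Q : A → Set} {k} → (∀ {x} → P x → Q x) → (∀ {x} → Q x → P x) → HasSize P k → HasSize Q k
HasSize-resp to from (xs , len≡ , xs! , P⇔xs) =
  xs , len≡ , xs! , λ x → mk⇔ (Equivalence.to (P⇔xs x) ∘ from) (to ∘ Equivalence.from (P⇔xs x))

HasSize-image : ∀ {A B : Set} {P : A → Set} {k} (f : A → B) → (∀ {x y} → P x → P y → f x ≡ f y → x ≡ y) →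
  HasSize P k → HasSize (λ y → ∃ λ x → P x × f x ≡ y) k
HasSize-image {P = P} f inj (xs , len≡ , xs! , P⇔xs) = map f xs , trans (Listₚ.length-map f xs) len≡ ,
  unique-map⁺ (λ {x} {y} x∈ y∈ → inj (Equivalence.from (P⇔xs x) x∈) (Equivalence.from (P⇔xs y) y∈)) xs! ,
  λ y → mk⇔ to (λ y∈ → from (∈-map⁻ f y∈))
  where
  to : ∀ {y} → (∃ λ x → P x × f x ≡ y) → y ∈ map f xs
  to (x , px , refl) = ∈-map⁺ f (Equivalence.to (P⇔xs x) px)
  from : ∀ {y} → (∃ λ x → x ∈ xs × y ≡ f x) → ∃ λ x → P x × f x ≡ y
  from (x , x∈ , refl) = x , Equivalence.from (P⇔xs x) x∈ , refl

count-size : ∀ {A B : Set} {P : B → Set} (f : A → B) xs {m} → Unique xs → Count P (map f xs) m →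
  HasSize (λ x → x ∈ xs × P (f x)) m
count-size f [] [] [] = [] , refl , [] , λ x → mk⇔ proj₁ (λ ())
count-size {P = P} f (x ∷ xs) (x∉ ∷ xs!) (hit px count) with count-size f xs xs! count
... | L , len≡ , L! , L⇔ = x ∷ L , cong suc len≡ ,
  All.tabulate (λ {y} y∈ → All.lookup x∉ (proj₁ (Equivalence.from (L⇔ y) y∈))) ∷ L! ,
  λ y → mk⇔ to from
  where
  to : ∀ {y} → y ∈ x ∷ xs × P (f y) → y ∈ x ∷ L
  to (here refl , _) = here refl
  to (there y∈ , py) = there (Equivalence.to (L⇔ _) (y∈ , py))
  from : ∀ {y} → y ∈ x ∷ L → y ∈ x ∷ xs × P (f y)
  from (here refl) = here refl , px
  from (there y∈)  = Product.map there id (Equivalence.from (L⇔ _) y∈)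
count-size {P = P} f (x ∷ xs) (x∉ ∷ xs!) (miss ¬px count) with count-size f xs xs! count
... | L , len≡ , L! , L⇔ = L , len≡ , L! , λ y → mk⇔ to (Product.map there id ∘ Equivalence.from (L⇔ y))
  where
  to : ∀ {y} → y ∈ x ∷ xs × P (f y) → y ∈ L
  to (here refl , py) = ⊥-elim (¬px py)
  to (there y∈ , py)  = Equivalence.to (L⇔ _) (y∈ , py)

code-injective : ∀ {k} (l m : Label k) → code l ≡ code m → l ≡ m
code-injective (a , b) (c , d) eq with Finₚ.combine-injective a b c d
  (Finₚ.toℕ-injective (trans (Finₚ.toℕ-combine a b) (trans eq (sym (Finₚ.toℕ-combine c d)))))
... | refl , refl = refl

∈-triples⁻ : ∀ {k} (ls : List (Label k)) {x y z} → (x , y , z) ∈ triples ls →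
  ∃ λ i → ∃₂ λ j l → (i , j) ∈ ls × (j , l) ∈ ls × x ≡ code (i , j) × y ≡ code (i , l) × z ≡ code (j , l)
∈-triples⁻ ls xyz∈ with find (∈-concatMap⁻ _ {xs = ls} xyz∈)
... | (i , j) , ij∈ , xyz∈′ with find (∈-concatMap⁻ _ {xs = ls} xyz∈′)
...   | (j′ , l) , jl∈ , xyz∈″ with eqFin j j′ in p
∈-triples⁻ ls _ | (i , j) , ij∈ , _ | (j′ , l) , jl∈ , here refl | true =
  i , j , l , ij∈ , subst (λ j → (j , l) ∈ ls) (sym (eq⁻ eqFin-isEqual j j′ p)) jl∈ , refl , refl , refl

-- A reflection ordering restricted to a model, and the resulting counts.

module _ {n k} {u : Word n} {bs : Vec ℕ k} (E : Embedding u bs) (O : ReflectionOrdering n) where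

  open Embedding E
  open Tracks
  open ReflectionOrdering O
  private module ≼ = IsTotalOrder isTotalOrder

  toTransp-irrelevant : ∀ l (p q : IsLabel bs l) → toTransp l p ≡ toTransp l q
  toTransp-irrelevant (a , b) p q = cong (tr (e a) (e b)) (Finₚ.<-irrelevant _ _)

  toTransp-injective : ∀ l m (p : IsLabel bs l) (q : IsLabel bs m) → toTransp l p ≡ toTransp m q → l ≡ m
  toTransp-injective l m p q eq = cong₂ _,_ (e-injective (cong Transp.a eq)) (e-injective (cong Transp.b eq))

  -- The ordering pulled back to numbers, as the tree requires; a number that is not the code of a
  -- label is related to nothing.
  _≤ₗ_ : ℕ → ℕ → Set
  x ≤ₗ y = ∃₂ λ l m → Σ (IsLabel bs l) λ isL → Σ (IsLabel bs m) λ isM →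
    x ≡ code l × y ≡ code m × toTransp l isL ≼ toTransp m isM

  ≤ₗ-code : ∀ l m (isL : IsLabel bs l) (isM : IsLabel bs m) → code l ≤ₗ code m → toTransp l isL ≼ toTransp m isM
  ≤ₗ-code l m isL isM (l′ , m′ , isL′ , isM′ , eqL , eqM , l′≼m′) with code-injective l l′ eqL | code-injective m m′ eqM
  ... | refl | refl = subst₂ _≼_ (toTransp-irrelevant l isL′ isL) (toTransp-irrelevant m isM′ isM) l′≼m′

  ≤ₗ-total : ∀ {x y} → x ∈ map code (allLabels bs) → y ∈ map code (allLabels bs) → x ≤ₗ y ⊎ y ≤ₗ x
  ≤ₗ-total x∈ y∈ with ∈-map⁻ code x∈ | ∈-map⁻ code y∈
  ... | l , l∈ , refl | m , m∈ , refl = Sum.map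
    (λ l≼m → l , m , isL , isM , refl , refl , l≼m) (λ m≼l → m , l , isM , isL , refl , refl , m≼l)
    (≼.total (toTransp l isL) (toTransp m isM))
    where
    isL = ∈-allLabels⁻ bs l∈
    isM = ∈-allLabels⁻ bs m∈

  ≤ₗ-antisym : ∀ {x y} → x ≤ₗ y → y ≤ₗ x → x ≡ y
  ≤ₗ-antisym (l , m , isL , isM , refl , refl , l≼m) y≤x =
    cong code (toTransp-injective l m isL isM (≼.antisym l≼m (≤ₗ-code m l isM isL y≤x)))

  ≤ₗ-trans : ∀ {x y z} → x ≤ₗ y → y ≤ₗ z → x ≤ₗ z
  ≤ₗ-trans (l , m , isL , isM , refl , refl , l≼m) (m′ , o , isM′ , isO , eqM , refl , m′≼o) with code-injective m m′ eqM
  ... | refl = l , o , isL , isO , refl , refl , ≼.trans l≼m (subst (_≼ toTransp o isO) (toTransp-irrelevant m isM′ isM) m′≼o)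

  -- `e` increases within a block, so i < j < l in one block becomes a triple to which `reflection`
  -- applies.
  ≤ₗ-between : ∀ {x y z} → (x , y , z) ∈ triples (allLabels bs) →
    x ∈ map code (allLabels bs) × y ∈ map code (allLabels bs) × z ∈ map code (allLabels bs) × x ≢ y × y ≢ z ×
    ((x ≤ₗ y × y ≤ₗ z) ⊎ (z ≤ₗ y × y ≤ₗ x))
  ≤ₗ-between xyz∈ with ∈-triples⁻ (allLabels bs) xyz∈
  ... | i , j , l , ij∈ , jl∈ , refl , refl , refl =
    ∈-map⁺ code ij∈ , ∈-map⁺ code (∈-allLabels⁺ bs isIL) , ∈-map⁺ code jl∈ ,
    (λ eq → Finₚ.<-irrefl (cong proj₂ (code-injective (i , j) (i , l) eq)) (proj₁ isJL)) ,
    (λ eq → Finₚ.<-irrefl (cong proj₁ (code-injective (i , l) (j , l) eq)) (proj₁ isIJ)) ,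
    Sum.map
      (λ (ij≼il , il≼jl) → (_ , _ , isIJ , isIL , refl , refl , ij≼il) , (_ , _ , isIL , isJL , refl , refl , il≼jl))
      (λ (jl≼il , il≼ij) → (_ , _ , isJL , isIL , refl , refl , jl≼il) , (_ , _ , isIL , isIJ , refl , refl , il≼ij))
      (reflection (e i) (e j) (e l) _ _ _)
    where
    isIJ = ∈-allLabels⁻ bs ij∈
    isJL = ∈-allLabels⁻ bs jl∈
    isIL : IsLabel bs (i , l)
    isIL = Finₚ.<-trans (proj₁ isIJ) (proj₁ isJL) , trans (proj₂ isIJ) (proj₂ isJL)

  open OrderTreeProperties (map code (allLabels bs)) _≤ₗ_ ≤ₗ-total ≤ₗ-antisym ≤ₗ-trans
    (triples (allLabels bs)) ≤ₗ-between

  <ₗ-trans : ∀ {x y z} → x <ₗ y → y <ₗ z → x <ₗ z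
  <ₗ-trans (x≤y , x≢y) (y≤z , _) = ≤ₗ-trans x≤y y≤z , λ where refl → x≢y (≤ₗ-antisym x≤y y≤z)

  -- `Increasing` speaks of arbitrary labels s, t of the edges; `label-unique` identifies them with
  -- the images of l and m.
  sorted⇒increasing : ∀ {h x σ} {ls : Labels k h} → Tracks x σ → Ascending bs σ ls → Sorted (codes ls) → Increasing O (decode x ls)
  sorted⇒increasing {x = x} tracks (cons {l = l} isL _ (cons {l = m} isM _ _)) ((l<m ∷ _) ∷ _) zero (suc zero) _ s t (s-act , _) (t-act , _) =
    subst₂ _≼_ (label-unique x (perm tracks) {toTransp l isL} {s} s-act)
      (label-unique (act l x) (perm (tracks-exchange l isL tracks)) {toTransp m isM} {t} t-act)
      (≤ₗ-code l m isL isM (proj₁ l<m))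
  sorted⇒increasing tracks (cons {l = l} isL _ asc) (_ ∷ sorted) (suc i) (suc j) eq s t =
    sorted⇒increasing (tracks-exchange l isL tracks) asc sorted i j (ℕₚ.suc-injective eq) s t

  increasing⇒linked : ∀ {h x σ} {ls : Labels k h} → Tracks x σ → Ascending bs σ ls → Increasing O (decode x ls) → Linked _<ₗ_ (codes ls)
  increasing⇒linked tracks [] _ = []
  increasing⇒linked tracks (cons _ _ []) _ = [-]
  increasing⇒linked {x = x} tracks (cons {l = l} isL up asc@(cons {l = m} isM up′ _)) inc =
    ((l , m , isL , isM , refl , refl , inc zero (suc zero) refl (toTransp l isL) (toTransp m isM)
      (refl , longer) (refl , longer′)) , distinct ∘ code-injective l m) ∷
    increasing⇒linked tracks′ asc (λ i j eq s t → inc (suc i) (suc j) (cong suc eq) s t)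
    where
    tracks′ = tracks-exchange l isL tracks
    longer = rises⇒longer l isL tracks up
    longer′ = rises⇒longer m isM tracks′ up′
    -- A repeated label would undo the step before it, while the length grows.
    distinct : l ≢ m
    distinct refl = ℕₚ.<-asym longer (subst (λ y → len (act l x) ℕ.< len y) (swapValues-involutive _ _ x) longer′)

  increasing⇒sorted : ∀ {h x σ} {ls : Labels k h} → Tracks x σ → Ascending bs σ ls → Increasing O (decode x ls) → Sorted (codes ls)
  increasing⇒sorted tracks asc inc = Linkedₚ.Linked⇒AllPairs <ₗ-trans (increasing⇒linked tracks asc inc)

  codes-∈ : ∀ {h σ} {ls : Labels k h} → Ascending bs σ ls → All (_∈ map code (allLabels bs)) (codes ls)
  codes-∈ []               = []
  codes-∈ (cons isL _ asc) = ∈-map⁺ code (∈-allLabels⁺ bs isL) ∷ codes-∈ asc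

  module _ {σ : State k} (tracks : Tracks u σ) {q₀ q : Labels k 4} {C : List (Labels k 4)}
    (q₀-ascending : Ascending bs σ q₀) (result : Search.search eqLabels (flips σ) 100 (q₀ ∷ [] , q₀ ∷ []) ≡ (C , []))
    (q₀⇒q : q₀ ∈ C → q ∈ C)
    (class-ok : checkClass (orderTree (triples (allLabels bs)) (length (allLabels bs)) (map code (allLabels bs))) σ C ≡ true) where

    private
      Reached : Labels k 4 → Set
      Reached ls = Ascending bs σ ls × InFlipclass (decode u q₀) (decode u ls)

      reached-flips : ∀ {ls ms} → Reached ls → ms ∈ flips σ ls → Reached ms
      reached-flips {ls} (asc , reach) ms∈ with flips-sound ls tracks asc ms∈
      ... | asc′ , change = asc′ , reach ◅◅ flipStep⁺ (decode-path tracks asc) (decode-path tracks asc′) change ◅ ε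

      search-closure : q₀ ∈ C × Unique C × (∀ {ls} → ls ∈ C → Reached ls) × (∀ {ls ms} → ls ∈ C → ms ∈ flips σ ls → ms ∈ C)
      search-closure = SearchProperties.closure (eqVec-isEqual eqLabel-isEqual) (flips σ) Reached reached-flips 100 (q₀-ascending , ε) result

      C-unique : Unique C
      C-unique = proj₁ (proj₂ search-closure)

      C-reached : ∀ {ls} → ls ∈ C → Reached ls
      C-reached = proj₁ (proj₂ (proj₂ search-closure))

      q∈C : q ∈ C
      q∈C = q₀⇒q (proj₁ search-closure)

      -- Induction along the chain of flips: each is found among `flips` by `flips-complete`, and C
      -- is closed under these.
      flipclass⇒C : ∀ {ls y} → ls ∈ C → InFlipclass (decode u ls) y → ∃ λ ms → ms ∈ C × decode u ms ≡ y
      flipclass⇒C ls∈ ε = _ , ls∈ , refl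
      flipclass⇒C {ls} ls∈ (_◅_ {j = z} flip rest) with flipStep⁻ {p = decode u ls} {z} flip
      ... | _ , path , change with flips-complete tracks (proj₁ (C-reached ls∈)) path change
      ...   | ms , ms∈ , refl = flipclass⇒C (proj₂ (proj₂ (proj₂ search-closure)) ls∈ ms∈) rest

      C⇒flipclass : ∀ {ls} → ls ∈ C → InFlipclass (decode u q) (decode u ls)
      C⇒flipclass ls∈ = inFlipclass-sym (proj₂ (C-reached q∈C)) ◅◅ proj₂ (C-reached ls∈)

    flipclass-tVector : ∀ i → HasSize (TSet (decode u q) i) (lookup (tVector σ C) i)
    flipclass-tVector i = HasSize-resp to from (subst (HasSize _) (sym size≡)
      (image-size (eqVec-isEqual eqFin-isEqual) (λ ls → lookup (run σ ls) i) (λ ls → lookup (decode u ls) i) C agree))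
      where
      tracksAt : ∀ {ls} → ls ∈ C → Tracks (lookup (decode u ls) i) (lookup (run σ ls) i)
      tracksAt ls∈ = decode-tracks tracks (proj₁ (C-reached ls∈)) i
      agree : ∀ {ls ms} → ls ∈ C → ms ∈ C → _
      agree ls∈ ms∈ =
        (λ eq → tracks-wordUnique (tracksAt ls∈) (subst (Tracks _) (sym eq) (tracksAt ms∈))) ,
        (λ eq → tracks-stateUnique (tracksAt ls∈) (subst (λ x → Tracks x _) (sym eq) (tracksAt ms∈)))
      size≡ : lookup (tVector σ C) i ≡ length (nub eqState (map (λ ls → lookup (run σ ls) i) C))
      size≡ = trans (Vecₚ.lookup∘tabulate (λ i → length (nub eqState (column (map (run σ) C) i))) i)
        (cong (length ∘ nub eqState) (sym (Listₚ.map-∘ C)))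
      to : ∀ {x} → (∃ λ ls → ls ∈ C × lookup (decode u ls) i ≡ x) → TSet (decode u q) i x
      to (ls , ls∈ , eq) = decode u ls , C⇒flipclass ls∈ , eq
      from : ∀ {x} → TSet (decode u q) i x → ∃ λ ls → ls ∈ C × lookup (decode u ls) i ≡ x
      from (y , reach , eq) with flipclass⇒C q∈C reach
      ... | ls , ls∈ , refl = ls , ls∈ , eq

    flipclass-increasing : HasSize (IncSet O (decode u q)) (cFormula (tVector σ C))
    flipclass-increasing with countsTo-correct (cFormula (tVector σ C)) (length (allLabels bs)) (map code (allLabels bs)) 0 (map codes C)
      -- At the root no label has been chosen, so `ReverseClosed` holds vacuously.
      id (λ x∈ x∉ → ⊥-elim (x∉ x∈)) (Allₚ.map⁺ (All.tabulate (codes-∈ ∘ proj₁ ∘ C-reached))) class-ok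
    ... | m , count , refl = HasSize-resp to from (HasSize-image (decode u)
        (λ (ls∈ , _) (ms∈ , _) → decode-injective tracks (proj₁ (C-reached ls∈)) (proj₁ (C-reached ms∈)))
        (count-size codes C C-unique count))
      where
      to : ∀ {y} → (∃ λ ls → (ls ∈ C × Sorted (codes ls)) × decode u ls ≡ y) → IncSet O (decode u q) y
      to (ls , (ls∈ , sorted) , refl) = C⇒flipclass ls∈ , sorted⇒increasing tracks (proj₁ (C-reached ls∈)) sorted
      from : ∀ {y} → IncSet O (decode u q) y → ∃ λ ls → (ls ∈ C × Sorted (codes ls)) × decode u ls ≡ y
      from (reach , inc) with flipclass⇒C q∈C reach
      ... | ls , ls∈ , refl = ls , (ls∈ , increasing⇒sorted tracks (proj₁ (C-reached ls∈)) inc) , refl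

-- A lexicographically increasing path in every flipclass.

module _ {n k} {u : Word n} {bs : Vec ℕ k} (E : Embedding u bs) where

  open Embedding E
  open Tracks

  tracks-∈-allStates : ∀ {x σ} → Tracks x σ → σ ∈ allStates bs
  tracks-∈-allStates {x} {σ} tracks = ∈-allStates bs σ (block tracks)
    (λ i j eq → e-injective (trans (sym (on tracks i)) (trans (cong (lookup x ∘ r) eq) (on tracks j))))

  module _ (descents : ∀ {σ} → σ ∈ allStates bs → descentsFlip (allLabels bs) σ ≡ true) where

    -- `descentsFlip` settles the pair l, m at the state σ; `flips-extend` attaches the rest of the
    -- path.
    descent-flip : ∀ {h x σ l m} {ls : Labels k h} → Tracks x σ → Ascending bs σ (l ∷ m ∷ ls) → code m ℕ.≤ code l →
      ∃₂ λ l′ m′ → code l′ ℕ.< code l × (l′ ∷ m′ ∷ ls) ∈ flips σ (l ∷ m ∷ ls)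
    descent-flip {σ = σ} {l} {m} {ls} tracks (cons isL up (cons isM up′ _)) m≤l with some⁻ _ (flips σ (l ∷ m ∷ [])) smaller
      where
      smaller : some (λ q → code (Vec.head q) ℕ.<ᵇ code l) (flips σ (l ∷ m ∷ [])) ≡ true
      smaller with every⁻ (descentFlips σ l) (allLabels bs)
        (every⁻ (λ l → every (descentFlips σ l) (allLabels bs)) (allLabels bs) (descents (tracks-∈-allStates tracks)) (∈-allLabels⁺ bs isL))
        (∈-allLabels⁺ bs isM)
      ... | found rewrite ≤⇒≤ᵇ-true m≤l | up | up′ = found
    ... | (l′ ∷ m′ ∷ []) , l′m′∈ , l′<l = l′ , m′ , ℕₚ.<ᵇ⇒< _ _ (subst T (sym l′<l) tt) , flips-extend σ l m l′ m′ ls l′m′∈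

    Straight : ∀ {h} → Word n → State k → Labels k h → Set
    Straight x σ q = ∃ λ q′ → Ascending bs σ q′ × CodesFrom 0 q′ × InFlipclass (decode x q) (decode x q′)

    Straightens : ℕ → Set
    Straightens h = ∀ {x σ} (q : Labels k h) → Tracks x σ → Ascending bs σ q → Straight x σ q

    -- Straighten the tail first; flipping a remaining descent at the head lowers the first label.
    straighten-cons : ∀ {h} → Straightens h → ∀ l (q : Labels k h) → Acc ℕ._<_ (code l) →
      ∀ {x σ} → Tracks x σ → IsLabel bs l → rises σ l ≡ true → Ascending bs (exchange l σ) q → Straight x σ (l ∷ q)
    straighten-cons tail l q (acc smaller) tracks isL up asc with tail q (tracks-exchange l isL tracks) asc
    ... | [] , asc′ , [] , reach = l ∷ [] , cons isL up asc′ , z≤n ∷ [] , inFlipclass-cons (decode-path tracks (cons isL up asc)) reach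
    ... | m ∷ q′ , asc′ , _ ∷ from , reach with suc (code l) ℕ.≤? code m
    ...   | yes l<m = l ∷ m ∷ q′ , cons isL up asc′ , z≤n ∷ l<m ∷ from , inFlipclass-cons (decode-path tracks (cons isL up asc)) reach
    ...   | no l≮m with descent-flip tracks (cons isL up asc′) (ℕₚ.≮⇒≥ l≮m)
    ...     | l′ , m′ , l′<l , flip∈ with flips-sound (l ∷ m ∷ q′) tracks (cons isL up asc′) flip∈
    ...       | asc″@(cons isL′ up′ asc‴) , change with straighten-cons tail l′ (m′ ∷ q′) (smaller l′<l) tracks isL′ up′ asc‴
    ...         | q″ , asc⁗ , from″ , reach″ = q″ , asc⁗ , from″ ,
      inFlipclass-cons (decode-path tracks (cons isL up asc)) reach ◅◅
      (flipStep⁺ (decode-path tracks (cons isL up asc′)) (decode-path tracks asc″) change ◅ reach″)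

    straighten : ∀ h → Straightens h
    straighten zero    []      tracks asc = [] , asc , [] , ε
    straighten (suc h) (l ∷ q) tracks (cons isL up asc) =
      straighten-cons (straighten h) l q (<-wellFounded (code l)) tracks isL up asc

  -- The check meets the flipclass of q through the increasing path q′ in it. The sets counted
  -- depend on the flipclass only, so their sizes carry over from q′ to q, and uniqueness of sizes
  -- makes the given t equal to `tVector σ C`.
  flipclass-formula : (O : ReflectionOrdering n) → ∀ {σ} → checkBlocks bs ≡ true → Tracks u σ → ∀ q → Ascending bs σ q →
    (t : Vec ℕ 5) → (∀ i → HasSize (TSet (decode u q) i) (lookup t i)) → HasSize (IncSet O (decode u q)) (cFormula t)
  flipclass-formula O {σ} ok tracks q q-asc t t-sizes
    with straighten (λ σ∈ → proj₁ (checkStates⁻ (allLabels bs) _ (allStates bs) ok σ∈)) 4 q tracks q-asc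
  ... | q′ , q′-asc , q′-codes , reach
    with checkPaths⁻ 100 _ (increasingPaths (allLabels bs) 4 0 σ) (Ascending bs σ) (All.tabulate (∈-increasingPaths⁻ bs {b = 0}))
      (proj₂ (checkStates⁻ (allLabels bs) _ (allStates bs) ok (tracks-∈-allStates tracks))) (∈-increasingPaths⁺ bs q′-asc q′-codes)
  ...   | C , q₀ , q₀-asc , result , q₀⇒q′ , class-ok =
    HasSize-resp (inFlipclass-incSet O (inFlipclass-sym reach)) (inFlipclass-incSet O reach) (subst (HasSize _ ∘ cFormula)
      (Vec-ext (λ i → HasSize-unique (flipclass-tVector E O tracks q₀-asc result q₀⇒q′ class-ok i)
        (HasSize-resp (inFlipclass-tSet reach) (inFlipclass-tSet (inFlipclass-sym reach)) (t-sizes i))))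
      (flipclass-increasing E O tracks q₀-asc result q₀⇒q′ class-ok))

-- Placing an arbitrary path of length 4 in a model.

-- As `e` increases within a block, a < b forces the preimages to satisfy i < j, which makes them a
-- label.
joined-image : ∀ {n} {u : Word n} {Bs} (L : Layout u Bs) t → Joined Bs (Transp.a t) (Transp.b t) → Embedding.IsImage (layout-embedding L) t
joined-image L (tr a b a<b) joined with Layout.e-onto L joined
... | i , j , refl , refl , same with Finₚ.<-cmp i j
...   | tri< i<j _ _ = (i , j) , (i<j , same) , cong (tr a b) (Finₚ.<-irrelevant _ _)
...   | tri≈ _ refl _ = ⊥-elim (Finₚ.<-irrefl refl a<b)
...   | tri> _ _ j<i = ⊥-elim (Finₚ.<-asym a<b (Layout.e-mono L j<i (sym same)))

-- The evaluation of all models; the largest is the symmetric group on five values.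
checked : checkAll (blockSizes 4) ≡ true
checked = refl

theorem7p10 : (n : ℕ) (O : ReflectionOrdering n) (u v : Word n) (p : PathV n 4) →
    IsPathFromTo u v p →
    (t : Vec ℕ 5) → (∀ (i : Fin 5) → HasSize (TSet p i) (lookup t i)) →
    Σ ℕ λ c → HasSize (IncSet O p) c × c ≡ cFormula t
theorem7p10 n O _ _ (u ∷ ys) (isPath , refl , _) t t-sizes = conclude (encode tracks path images)
  where
  path : Path (u ∷ ys)
  path = path⁺ isPath
  u-perm : IsPerm u
  u-perm = proj₁ isPath zero
  open Partition (proj₁ (partition (labels path)))
  Bs = filter isBig? blocks
  L : Layout u Bs
  L = layout u u-perm Bs (AllPairsₚ.filter⁺ isBig? disjoint) (Allₚ.filter⁺ isBig? uniques)
  open Layout L using (sizes; σ)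
  bs = blockIds sizes
  E = layout-embedding L
  open Embedding E using (Tracks; decode; encode; IsImage)
  τ = Vec.tabulate σ
  tracks : Tracks u τ
  tracks = layout-tracks u-perm L
  images : VecAll.All IsImage (labels path)
  images = VecAll.map (λ {t} (B , B∈ , a∈ , b∈) → joined-image L t
    (B , ∈-filter⁺ isBig? B∈ (joined-isBig (λ eq → Finₚ.<-irrefl eq (Transp.a<b t)) a∈ b∈) , a∈ , b∈))
    (proj₂ (partition (labels path)))
  sizes∈ : sizes ∈ blockSizes 4
  sizes∈ = ∈-blockSizes 4 sizes (Allₚ.map⁺ (Allₚ.all-filter isBig? blocks))
    (subst (ℕ._≤ 4) (cong sum (Listₚ.map-∘ Bs)) (ℕₚ.≤-trans (excess-filter blocks) bounded))
  conclude : (∃ λ q → Ascending bs τ q × u ∷ ys ≡ decode u q) → Σ ℕ λ c → HasSize (IncSet O (u ∷ ys)) c × c ≡ cFormula t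
  conclude (q , q-asc , eq) = cFormula t , subst (λ p → HasSize (IncSet O p) (cFormula t)) (sym eq)
    (flipclass-formula E O (checkAll⁻ (blockSizes 4) checked sizes∈) tracks q q-asc t
      (λ i → subst (λ p → HasSize (TSet p i) (lookup t i)) eq (t-sizes i))) , refl
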